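{- Let $q$ be a prime power, $n\ge1$, and let $0\le d\le n(q-1)$. Write $d=u(q-1)+v$ with integers $u\ge 0$ and $0\le v<q-1$. Fix any ordering $\xi_0,\ldots,\xi_{q-1}$ of the elements of $\mathbb{F}_q$, let $b_i(X)=\prod_{j<i}(X-\xi_j)$ for $0\le i\le q-1$, and let \[ f=b_v(X_{u+1})\cdot\prod_{i=1}^{u}b_{q-1}(X_i)\in\mathcal{P}_q(n),\qquad m_0=X_1^{q-1}\cdots X_u^{q-1}X_{u+1}^{v}. \] Then, for any integers $e,s\ge 0$, \[ \Pr_{P}\left[\deg(fP)<d+s\right]=\frac{1}{q^{|U_{s,e}(m_0)|}}, \] where $P$ is uniformly random in $\mathcal{P}_q(n,e)$.
   Context: $\mathcal{P}_q(n)$ is the ring $\mathbb{F}_q[X_1,\ldots,X_n]/\langle X_1^q-X_1,\ldots,X_n^q-X_n\rangle$. Its elements are identified with polynomials in $\mathbb{F}_q[X_1,\ldots,X_n]$ of individual degree at most $q-1$ in each variable, and degree means total degree of this representative; $\deg 0=-\infty$. $\mathcal{P}_q(n,e)$ is the set of elements of degree at most $e$. The product $fP$ is taken in $\mathcal{P}_q(n)$. For a monomial $m=\prod_{j=1}^nX_j^{e_j}$ with all $e_j<q$ and an integer $t\ge0$, $U_t(m)=\{\prod_{j}X_j^{e_j'} : \sum_je_j'=\deg(m)+t \text{ and } e_j\le e_j'<q \text{ for all } j\}$, and $U_{s,e}(m)=\bigcup_{s\le t\le e}U_t(m)$ (empty if $s>e$). When $v=0$ the factors $b_v(X_{u+1})$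 and $X_{u+1}^v$ are $1$. -}

module Defs where

open import Algebra.Bundles using (CommutativeRing)
open import Data.Bool.Base using (if_then_else_)
open import Data.Fin.Base using (Fin; toℕ)
import Data.Fin.Properties as Fin
open import Data.Integer.Base using (+_)
open import Data.List.Base as List using (List; []; _∷_; foldr)
open import Data.Nat.Base as ℕ using (ℕ; zero; suc; NonZero; _≤_; _<_; _∸_)
import Data.Nat.Properties as ℕ
open import Data.Nat.Primality using (Prime)
open import Data.Product.Base using (Σ; ∃-syntax; _×_; proj₁)
open import Data.Rational.Base using (ℚ; _/_)
open import Data.Vec.Base as Vec using (Vec; []; _∷_)
open import Data.Vec.Relation.Binary.Pointwise.Inductive as Pointwise
  using (Pointwise)
open import Function.Bundles using (Bijection; Inverse)
open import Function.Properties.Bijection using (Bijection⇒Inverse)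
open import Function.Properties.Inverse as Inverse using (Inverse⇒Injection)
open import Level using (Level) renaming (_⊔_ to _⊔ˡ_; suc to sucˡ)
open import Relation.Binary.Bundles using (Setoid)
import Relation.Binary.Construct.Add.Infimum.NonStrict as NonStrict
import Relation.Binary.Construct.Add.Infimum.Strict as Strict
import Relation.Binary.Construct.On as On
open import Relation.Binary.Definitions using (Decidable)
open import Relation.Binary.PropositionalEquality using (_≡_)
import Relation.Binary.PropositionalEquality.Properties as ≡
open import Relation.Nullary.Construct.Add.Infimum using (_₋; ⊥₋; [_])
open import Relation.Nullary.Decidable
  using (does; _×-dec_; via-injection)
open import Relation.Nullary.Negation using (¬_)
import Relation.Unary as U

private
  variable
    a ℓ₁ p c ℓ : Level

IsPrimePower : ℕ → Set
IsPrimePower q = ∃[ p ] ∃[ k ] (Prime p × 1 ≤ k × q ≡ p ℕ.^ k)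

record Field (c ℓ : Level) : Set (sucˡ (c ⊔ˡ ℓ)) where
  field
    commutativeRing : CommutativeRing c ℓ
  open CommutativeRing commutativeRing public
  field
    1≉0     : ¬ (1# ≈ 0#)
    inverse : ∀ x → ¬ (x ≈ 0#) → ∃[ y ] (x * y ≈ 1#)

-- A listing of the elements of S, up to its equality, without repetition;
-- in particular S has exactly k elements.
Ordering : ℕ → Setoid a ℓ₁ → Set (a ⊔ˡ ℓ₁)
Ordering k S = Bijection (≡.setoid (Fin k)) S

Restrict : (S : Setoid a ℓ₁) → (Setoid.Carrier S → Set p) → Setoid (a ⊔ˡ p) ℓ₁
Restrict S E = On.setoid {B = Σ (Setoid.Carrier S) E} S proj₁

-- The event E has probability r for a uniformly random element of the finite
-- nonempty setoid S.
record Probability (S : Setoid a ℓ₁) (E : Setoid.Carrier S → Set p) (r : ℚ)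
       : Set (a ⊔ˡ ℓ₁ ⊔ˡ p) where
  field
    outcomes favourable : ℕ
    {{outcomes≢0}}      : NonZero outcomes
    allOutcomes         : Ordering outcomes S
    allFavourable       : Ordering favourable (Restrict S E)
    ratio               : (+ favourable) / outcomes ≡ r

open Strict _<_ public using (_<₋_)
open NonStrict _≤_ public using (_≤₋_)

_⊔₋_ : ℕ ₋ → ℕ ₋ → ℕ ₋
⊥₋    ⊔₋ y     = y
[ x ] ⊔₋ ⊥₋    = [ x ]
[ x ] ⊔₋ [ y ] = [ x ℕ.⊔ y ]

module ReducedPolynomials
  (F : Field c ℓ) (q : ℕ) (ξ : Ordering q (Field.setoid F)) where

  private module F = Field F

  index : Inverse F.setoid (≡.setoid (Fin q))
  index = Inverse.sym (Bijection⇒Inverse ξ)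

  _≟_ : Decidable F._≈_
  _≟_ = via-injection (Inverse⇒Injection index) Fin._≟_

  instance
    q≢0 : NonZero q
    q≢0 = Fin.nonZeroIndex (Inverse.to index F.0#)

  infixl 6 _+ₚ_
  infixl 7 _*ₚ_
  infix  8 -ₚ_
  infixr 9 _^ₚ_
  infix  4 _≈ₚ_

  data Poly (n : ℕ) : Set c where
    con       : F.Carrier → Poly n
    X         : Fin n → Poly n
    _+ₚ_ _*ₚ_ : Poly n → Poly n → Poly n
    -ₚ_       : Poly n → Poly n

  _^ₚ_ : ∀ {n} → Poly n → ℕ → Poly n
  x ^ₚ zero  = con F.1#
  x ^ₚ suc k = x *ₚ (x ^ₚ k)

  -- Equality in F[X₁,…,Xₙ]/⟨X₁^q - X₁,…,Xₙ^q - Xₙ⟩: without the last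
  -- constructor this is equality in the free commutative F-algebra on
  -- X₁,…,Xₙ, i.e. in F[X₁,…,Xₙ]; the least congruence that also contains the
  -- pairs (Xᵢ^q , Xᵢ) is congruence modulo the ideal.
  data _≈ₚ_ {n : ℕ} : Poly n → Poly n → Set (c ⊔ˡ ℓ) where
    reflₚ  : ∀ {x} → x ≈ₚ x
    symₚ   : ∀ {x y} → x ≈ₚ y → y ≈ₚ x
    transₚ : ∀ {x y z} → x ≈ₚ y → y ≈ₚ z → x ≈ₚ z

    +-cong : ∀ {x x′ y y′} → x ≈ₚ x′ → y ≈ₚ y′ → x +ₚ y ≈ₚ x′ +ₚ y′
    *-cong : ∀ {x x′ y y′} → x ≈ₚ x′ → y ≈ₚ y′ → x *ₚ y ≈ₚ x′ *ₚ y′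
    -‿cong : ∀ {x x′} → x ≈ₚ x′ → -ₚ x ≈ₚ -ₚ x′

    +-assoc     : ∀ x y z → (x +ₚ y) +ₚ z ≈ₚ x +ₚ (y +ₚ z)
    +-comm      : ∀ x y → x +ₚ y ≈ₚ y +ₚ x
    +-identityˡ : ∀ x → con F.0# +ₚ x ≈ₚ x
    -‿inverseˡ  : ∀ x → (-ₚ x) +ₚ x ≈ₚ con F.0#
    *-assoc     : ∀ x y z → (x *ₚ y) *ₚ z ≈ₚ x *ₚ (y *ₚ z)
    *-comm      : ∀ x y → x *ₚ y ≈ₚ y *ₚ x
    *-identityˡ : ∀ x → con F.1# *ₚ x ≈ₚ x
    distribˡ    : ∀ x y z → x *ₚ (y +ₚ z) ≈ₚ (x *ₚ y) +ₚ (x *ₚ z)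

    con-cong : ∀ {k l} → k F.≈ l → con k ≈ₚ con l
    con-+    : ∀ k l → con (k F.+ l) ≈ₚ con k +ₚ con l
    con-*    : ∀ k l → con (k F.* l) ≈ₚ con k *ₚ con l

    X^q≈X : ∀ i → X i ^ₚ q ≈ₚ X i

  𝒫 : ℕ → Setoid c (c ⊔ˡ ℓ)
  𝒫 n = record
    { Carrier       = Poly n
    ; _≈_           = _≈ₚ_
    ; isEquivalence = record { refl = reflₚ ; sym = symₚ ; trans = transₚ }
    }

  sumₚ productₚ : ∀ {n} → List (Poly n) → Poly n
  sumₚ     = foldr _+ₚ_ (con F.0#)
  productₚ = foldr _*ₚ_ (con F.1#)

  -- Exponent vectors of the monomials of individual degree at most q - 1.
  Monomial : ℕ → Set
  Monomial n = Vec (Fin q) n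

  exponents : ∀ {n} → Monomial n → Vec ℕ n
  exponents = Vec.map toℕ

  degᵐ : ∀ {n} → Monomial n → ℕ
  degᵐ m = Vec.sum (exponents m)

  monomials : ∀ n → List (Monomial n)
  monomials zero    = [] ∷ []
  monomials (suc n) =
    List.cartesianProductWith _∷_ (List.allFin q) (monomials n)

  monomial : ∀ {n} → Monomial n → Poly n
  monomial {n} m =
    productₚ (List.map (λ j → X j ^ₚ toℕ (Vec.lookup m j)) (List.allFin n))

  -- Polynomials of individual degree at most q - 1, by their coefficients.
  Reduced : ℕ → Set c
  Reduced n = Monomial n → F.Carrier

  ⟦_⟧ : ∀ {n} → Reduced n → Poly n
  ⟦_⟧ {n} r = sumₚ (List.map (λ m → con (r m) *ₚ monomial m) (monomials n))

  -- Total degree, with ⊥₋ = -∞ for the zero polynomial.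
  deg : ∀ {n} → Reduced n → ℕ ₋
  deg {n} r = foldr (λ m δ → if does (r m ≟ F.0#) then δ else ([ degᵐ m ] ⊔₋ δ))
                    ⊥₋ (monomials n)

  -- The degree of an element of the quotient is that of its (unique) reduced
  -- representative.
  HasDegree : ∀ {n} → Poly n → ℕ ₋ → Set (c ⊔ˡ ℓ)
  HasDegree x δ = ∃[ r ] (⟦ r ⟧ ≈ₚ x × deg r ≡ δ)

  Degree≤ Degree< : ∀ {n} → ℕ → Poly n → Set (c ⊔ˡ ℓ)
  Degree≤ k x = ∃[ δ ] (HasDegree x δ × δ ≤₋ [ k ])
  Degree< k x = ∃[ δ ] (HasDegree x δ × δ <₋ [ k ])

  𝒫≤ : ℕ → ℕ → Setoid (c ⊔ˡ ℓ) (c ⊔ˡ ℓ)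
  𝒫≤ n e = Restrict (𝒫 n) (Degree≤ e)

  b : ∀ {n} → ℕ → Poly n → Poly n
  b i x = productₚ (List.map (λ k → x +ₚ (-ₚ con k))
                             (List.take i (List.tabulate (Bijection.to ξ))))

  -- The exponents of X₁^(q-1) ⋯ Xᵤ^(q-1) Xᵤ₊₁^v. Indices in Fin n start at 0,
  -- so Xᵤ₊₁ is the variable of index u; there is none when u = n.
  m₀ : ∀ n → ℕ → ℕ → Vec ℕ n
  m₀ n u v = Vec.tabulate λ j →
    if does (toℕ j ℕ.<? u) then q ∸ 1
    else if does (toℕ j ℕ.≟ u) then v
    else 0

  -- b_v(Xᵤ₊₁) · ∏_{i ≤ u} b_{q-1}(Xᵢ); the variables not occurring in m₀
  -- contribute b₀ = 1.
  f : ∀ n → ℕ → ℕ → Poly n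
  f n u v = productₚ (List.map (λ j → b (Vec.lookup (m₀ n u v) j) (X j))
                               (List.allFin n))

  -- The bounds e′ⱼ < q are built into Monomial.
  Uₜ : ∀ {n} → ℕ → Vec ℕ n → Monomial n → Set
  Uₜ t m m′ = degᵐ m′ ≡ Vec.sum m ℕ.+ t × Pointwise _≤_ m (exponents m′)

  Uₜ? : ∀ {n} t (m : Vec ℕ n) → U.Decidable (Uₜ t m)
  Uₜ? t m m′ =
    (degᵐ m′ ℕ.≟ Vec.sum m ℕ.+ t) ×-dec Pointwise.decidable ℕ._≤?_ m (exponents m′)

  U[_,_] : ∀ {n} → ℕ → ℕ → Vec ℕ n → Monomial n → Set
  U[ s , e ] m m′ = ∃[ t ] (t < suc e × (s ≤ t × Uₜ t m m′))

  U[_,_]? : ∀ {n} s e (m : Vec ℕ n) → U.Decidable (U[ s , e ] m)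
  U[ s , e ]? m m′ = ℕ.anyUpTo? (λ t → (s ℕ.≤? t) ×-dec Uₜ? t m m′) (suc e)

  ∣U[_,_]∣ : ∀ {n} → ℕ → ℕ → Vec ℕ n → ℕ
  ∣U[_,_]∣ {n} s e m = List.length (List.filter (U[ s , e ]? m) (monomials n))

{-# OPTIONS --safe #-}

-- For points η₀, η₁, … put Nᵢ(x) = ∏_{l<i} (x - ηₗ). Products over the variables
-- of such polynomials, with arbitrary points for each variable, form a basis of
-- the quotient ring: evaluating a combination successively at the points shows
-- that its coefficients are determined. As each factor is monic, changing the
-- points (to 0, 0, …, giving the monomials, in particular) respects degrees.
-- In the variable Xⱼ write k for the exponent in m₀, and use the points
-- ξ_k, ξ_{k+1}, … (indices mod q). Multiplication by b_k(Xⱼ) takes the i-th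
-- basis element for these points to the (k+i)-th one for the points ξ₀, ξ₁, …,
-- which is zero for k+i ≥ q because ∏_l (X - ξ_l) = X^q - X. Hence deg(fP) < d+s
-- if and only if the coefficients of P vanish at all exponent vectors m with
-- |m| ≥ s for which m₀ + m has all entries below q; those with |m| ≤ e
-- correspond to U_{s,e}(m₀) by m ↦ m₀ + m.

module Submission where

open import Defs
open import Algebra.Bundles using (CommutativeRing)
open import Algebra.Morphism.Construct.Identity using (isRingHomomorphism)
import Algebra.Morphism.Structures as Morphism
open import Data.Bool.Base using (true; false; if_then_else_)
open import Data.Fin.Base as Fin using (Fin; zero; suc; toℕ; funToFin; finToFun)
open import Data.Fin.Permutation using (Permutation′; permutation; _⟨$⟩ʳ_)
import Data.Fin.Properties as Fin
open import Data.Integer.Base using (+_)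
import Data.Integer.Properties as ℤ
open import Data.List.Base as List using (List; []; _∷_; foldr; _++_)
open import Data.List.Membership.Propositional using (_∈_)
open import Data.List.Membership.Propositional.Properties
  using (∈-allFin; ∈-cartesianProductWith⁺; ∈-lookup; ∈-filter⁺; ∈-filter⁻; ∈-map⁺; ∈-map⁻)
open import Data.List.Membership.Propositional.Properties.WithK
  using (unique⇒irrelevant; unique∧set⇒bag)
import Data.List.Properties as List
open import Data.List.Relation.Binary.BagAndSetEquality using (∼bag⇒↭)
open import Data.List.Relation.Binary.Permutation.Propositional.Properties using (↭-length)
import Data.List.Relation.Unary.All as ListAll
import Data.List.Relation.Unary.AllPairs as AllPairs
open import Data.List.Relation.Unary.Any as Any using (here; there)
import Data.List.Relation.Unary.Any.Properties as Any
open import Data.List.Relation.Unary.Unique.Propositional using (Unique)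
import Data.List.Relation.Unary.Unique.Propositional.Properties as Unique
open import Data.Nat.Base
  using (ℕ; zero; suc; _∸_; _≤_; _<_; NonZero; z≤n; s≤s; z<s; s<s)
import Data.Nat.Base as ℕ
open import Data.Nat.DivMod using (_mod_; _%_)
import Data.Nat.DivMod as ℕ
open import Data.Nat.Properties using (m^n≢0)
import Data.Nat.Properties as ℕ
open import Data.Product.Base using (∃-syntax; _×_; _,_; proj₁; proj₂)
open import Data.Rational.Base using (_/_)
import Data.Rational.Properties as ℚ
open import Data.Rational.Unnormalised.Base using (mkℚᵘ; *≡*)
open import Data.Vec.Base as Vec using (Vec; []; _∷_)
import Data.Vec.Functional as Vector
import Data.Vec.Properties as Vec
open import Data.Vec.Relation.Binary.Pointwise.Inductive using (Pointwise; []; _∷_)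
open import Data.Vec.Relation.Unary.All as All using (All; []; _∷_)
open import Function.Base using (_∘_; const; id)
open import Function.Bundles using (Inverse; Bijection; mk⇔)
open import Function.Definitions using (Injective)
open import Level using (_⊔_)
open import Relation.Binary.Bundles using (Setoid)
import Relation.Binary.Construct.Add.Infimum.NonStrict as NonStrict
import Relation.Binary.Construct.Add.Infimum.Strict as Strict
import Relation.Binary.Construct.On as On
open import Relation.Binary.PropositionalEquality as ≡ using (_≡_; _≢_)
open import Relation.Nullary.Construct.Add.Infimum using (_₋; ⊥₋; [_])
open import Relation.Nullary.Decidable.Core
  using (Dec; does; yes; no; _×-dec_; ¬?; decidable-stable)
open import Relation.Nullary.Negation using (¬_; contradiction)
open import Relation.Unary using (Decidable)
open import Algebra.Properties.CommutativeSemigroup ℕ.+-commutativeSemigroup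
  using (interchange)

-- Exponent vectors and delayed sequences.

infixl 6 _+ᵛ_
_+ᵛ_ : ∀ {n} → Vec ℕ n → Vec ℕ n → Vec ℕ n
_+ᵛ_ = Vec.zipWith ℕ._+_

-- The effect on coefficients of multiplying by the first `k` factors of a Newton basis. The default
-- `z` is a parameter because coefficients are ring elements in one variable and functions of the
-- later exponents in several.
delay : ∀ {a} {A : Set a} → A → ℕ → (ℕ → A) → ℕ → A
delay z zero    c i       = c i
delay z (suc k) c zero    = z
delay z (suc k) c (suc i) = delay z k c i

-- Newton expansions in one variable.

module Newton
  {c ℓ r ρ} (K : CommutativeRing c ℓ) (R : CommutativeRing r ρ)
  (con : CommutativeRing.Carrier K → CommutativeRing.Carrier R)
  (con-isHom : Morphism.RingMorphisms.IsRingHomomorphism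
    (CommutativeRing.rawRing K) (CommutativeRing.rawRing R) con)
  where

  private
    module K = CommutativeRing K
    module C = Morphism.RingMorphisms.IsRingHomomorphism con-isHom
  open CommutativeRing R hiding (zero)
  open import Relation.Binary.Reasoning.Setoid setoid
  open import Algebra.Solver.Ring.NaturalCoefficients.Default commutativeSemiring
    using (solve; _:+_; _:*_; _:=_)

  -- Points come from `K` and the argument from the `K`-algebra `R`, so the instance `R = K` yields
  -- the values of the polynomials that the instance at the quotient ring describes.
  newton : ℕ → (ℕ → K.Carrier) → Carrier → Carrier
  newton zero    η x = 1#
  newton (suc i) η x = (x - con (η 0)) * newton i (η ∘ suc) x

  -- ∑_{i<k} cᵢ Nᵢ(x), where Nᵢ = newton i η.
  horner : ℕ → (ℕ → Carrier) → (ℕ → K.Carrier) → Carrier → Carrier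
  horner zero    c η x = 0#
  horner (suc k) c η x = c 0 + (x - con (η 0)) * horner k (c ∘ suc) (η ∘ suc) x

  horner-cong : ∀ k {c c′ : ℕ → Carrier} η x → (∀ {i} → i < k → c i ≈ c′ i) →
                horner k c η x ≈ horner k c′ η x
  horner-cong zero    η x c≈c′ = refl
  horner-cong (suc k) η x c≈c′ =
    +-cong (c≈c′ z<s) (*-congˡ (horner-cong k (η ∘ suc) x (c≈c′ ∘ s<s)))

  horner-zero : ∀ k {c : ℕ → Carrier} η x → (∀ {i} → i < k → c i ≈ 0#) →
                horner k c η x ≈ 0#
  horner-zero zero    η x c≈0 = refl
  horner-zero (suc k) η x c≈0 = trans
    (+-cong (c≈0 z<s) (trans (*-congˡ (horner-zero k (η ∘ suc) x (c≈0 ∘ s<s))) (zeroʳ _)))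
    (+-identityˡ 0#)

  horner-sum : ∀ k (c c′ : ℕ → Carrier) η x →
               horner k (λ i → c i + c′ i) η x ≈ horner k c η x + horner k c′ η x
  horner-sum zero    c c′ η x = sym (+-identityˡ 0#)
  horner-sum (suc k) c c′ η x = trans
    (+-congˡ (*-congˡ (horner-sum k (c ∘ suc) (c′ ∘ suc) (η ∘ suc) x)))
    (solve 5 (λ a b y s t → a :+ b :+ y :* (s :+ t) := a :+ y :* s :+ (b :+ y :* t)) refl
      _ _ _ _ _)

  horner-scale : ∀ k s (c : ℕ → Carrier) η x →
                 horner k (λ i → s * c i) η x ≈ s * horner k c η x
  horner-scale zero    s c η x = sym (zeroʳ s)
  horner-scale (suc k) s c η x = trans
    (+-congˡ (*-congˡ (horner-scale k s (c ∘ suc) (η ∘ suc) x)))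
    (solve 4 (λ s a y t → s :* a :+ y :* (s :* t) := s :* (a :+ y :* t)) refl _ _ _ _)

  newton-+ : ∀ k i η x →
             newton (k ℕ.+ i) η x ≈ newton k η x * newton i (η ∘ (k ℕ.+_)) x
  newton-+ zero    i η x = sym (*-identityˡ _)
  newton-+ (suc k) i η x =
    trans (*-congˡ (newton-+ k i (η ∘ suc) x)) (sym (*-assoc _ _ _))

  horner-+ : ∀ k j c η x → horner (k ℕ.+ j) c η x ≈
             horner k c η x + newton k η x * horner j (c ∘ (k ℕ.+_)) (η ∘ (k ℕ.+_)) x
  horner-+ zero    j c η x = sym (trans (+-identityˡ _) (*-identityˡ _))
  horner-+ (suc k) j c η x = trans
    (+-congˡ (*-congˡ (horner-+ k j (c ∘ suc) (η ∘ suc) x)))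
    (solve 5 (λ a y s n t → a :+ y :* (s :+ n :* t) := a :+ y :* s :+ y :* n :* t) refl
      _ _ _ _ _)

  -- Each factor of `newton k η x` is a Horner step whose leading coefficient is zero.
  horner-delay : ∀ k j c η x →
                 newton k η x * horner j c (η ∘ (k ℕ.+_)) x ≈
                 horner (k ℕ.+ j) (delay 0# k c) η x
  horner-delay zero    j c η x = *-identityˡ _
  horner-delay (suc k) j c η x = begin
    (x - con (η 0)) * newton k (η ∘ suc) x * horner j c (η ∘ (suc k ℕ.+_)) x
      ≈⟨ *-assoc _ _ _ ⟩
    (x - con (η 0)) * (newton k (η ∘ suc) x * horner j c (η ∘ (suc k ℕ.+_)) x)
      ≈⟨ *-congˡ (horner-delay k j c (η ∘ suc) x) ⟩
    (x - con (η 0)) * horner (k ℕ.+ j) (delay 0# k c) (η ∘ suc) x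
      ≈⟨ +-identityˡ _ ⟨
    horner (suc k ℕ.+ j) (delay 0# (suc k) c) η x ∎

  -- The product has `k + q` terms. Those of index at least `q` contain `newton q η x` and vanish,
  -- so `q` terms suffice again.
  horner-annihilated : ∀ k q c η x → newton q η x ≈ 0# →
                       newton k η x * horner q c (η ∘ (k ℕ.+_)) x ≈
                       horner q (delay 0# k c) η x
  horner-annihilated k q c η x N≈0 = begin
    newton k η x * horner q c (η ∘ (k ℕ.+_)) x  ≈⟨ horner-delay k q c η x ⟩
    horner (k ℕ.+ q) c′ η x                     ≡⟨ ≡.cong (λ m → horner m c′ η x) (ℕ.+-comm k q) ⟩
    horner (q ℕ.+ k) c′ η x                     ≈⟨ horner-+ q k c′ η x ⟩
    horner q c′ η x + newton q η x * _          ≈⟨ +-congˡ (trans (*-congʳ N≈0) (zeroˡ _)) ⟩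
    horner q c′ η x + 0#                        ≈⟨ +-identityʳ _ ⟩
    horner q c′ η x                             ∎
    where c′ = delay 0# k c

  newton-root : ∀ k η {l} → l < k → newton k η (con (η l)) ≈ 0#
  newton-root (suc k) η {zero}  _         = trans (*-congʳ (-‿inverseʳ _)) (zeroˡ _)
  newton-root (suc k) η {suc l} (s<s l<k) =
    trans (*-congˡ (newton-root k (η ∘ suc) l<k)) (zeroʳ _)

  -- Change of points, with coefficients in a filtration.

  record IsFiltration {p} (Q : ℕ → Carrier → Set p) : Set (c ⊔ r ⊔ ρ ⊔ p) where
    field
      resp  : ∀ {i x y} → x ≈ y → Q i x → Q i y
      zero∈ : ∀ {i} → Q i 0#
      sum∈  : ∀ {i x y} → Q i x → Q i y → Q i (x + y)
      scale : ∀ {i x} s → Q i x → Q i (con s * x)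
      down  : ∀ {i x} → Q (suc i) x → Q i x

  tail-isFiltration : ∀ {p} {Q : ℕ → Carrier → Set p} →
                      IsFiltration Q → IsFiltration (Q ∘ suc)
  tail-isFiltration F = record
    { resp = resp ; zero∈ = zero∈ ; sum∈ = sum∈ ; scale = scale ; down = down }
    where open IsFiltration F

  -- `Q i` restricts the coefficient at index `i` and shrinks as `i` grows. If `Q i` means degree
  -- below `d ∸ i` in the other variables, membership bounds the total degree; if `Q` is `Constant`,
  -- it says that the coefficients are scalars.
  record Span {p} (Q : ℕ → Carrier → Set p) (k : ℕ) (η : ℕ → K.Carrier)
              (x y : Carrier) : Set (r ⊔ ρ ⊔ p) where
    constructor span
    field
      coefficient : ℕ → Carrier
      coefficient∈ : ∀ i → Q i (coefficient i)
      expansion : y ≈ horner k coefficient η x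

  module _ {p} {Q : ℕ → Carrier → Set p} where

    cons : ∀ {k η x a y} → Q 0 a → Span (Q ∘ suc) k (η ∘ suc) x y →
           Span Q (suc k) η x (a + (x - con (η 0)) * y)
    cons {k} {η} {x} {a} {y} a∈ (span c c∈ y≈) = span c′ c′∈ (+-congˡ (*-congˡ y≈))
      where
      c′ : ℕ → Carrier
      c′ zero    = a
      c′ (suc i) = c i
      c′∈ : ∀ i → Q i (c′ i)
      c′∈ zero    = a∈
      c′∈ (suc i) = c∈ i

    Span-resp : ∀ {k η x y z} → y ≈ z → Span Q k η x y → Span Q k η x z
    Span-resp y≈z (span c c∈ y≈) = span c c∈ (trans (sym y≈z) y≈)

  module _ {p} {Q : ℕ → Carrier → Set p} (Q-isFiltration : IsFiltration Q) where
    open IsFiltration Q-isFiltration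

    Span-zero : ∀ k η x → Span Q k η x 0#
    Span-zero k η x =
      span (const 0#) (λ _ → zero∈) (sym (horner-zero k η x (λ _ → refl)))

    Span-sum : ∀ {k η x y z} → Span Q k η x y → Span Q k η x z → Span Q k η x (y + z)
    Span-sum {k} {η} {x} (span c c∈ y≈) (span c′ c′∈ z≈) =
      span (λ i → c i + c′ i) (λ i → sum∈ (c∈ i) (c′∈ i))
        (trans (+-cong y≈ z≈) (sym (horner-sum k c c′ η x)))

  Span-const : ∀ {p} {Q : ℕ → Carrier → Set p} → IsFiltration Q →
               ∀ k η x {a} → Q 0 a → Span Q (suc k) η x a
  Span-const F k η x a∈ = Span-resp
    (trans (+-congˡ (zeroʳ _)) (+-identityʳ _))
    (cons a∈ (Span-zero (tail-isFiltration F) k (η ∘ suc) x))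

  con-- : ∀ a b → con (a K.- b) ≈ con a - con b
  con-- a b = trans (C.+-homo a (K.- b)) (+-congˡ (C.-‿homo b))

  x-y+y-z≈x-z : ∀ x y z → (x - y) + (y - z) ≈ x - z
  x-y+y-z≈x-z x y z = begin
    (x - y) + (y - z)    ≈⟨ solve 4 (λ x y′ y z′ →
                              (x :+ y′) :+ (y :+ z′) := (y′ :+ y) :+ (x :+ z′)) refl _ _ _ _ ⟩
    (- y + y) + (x - z)  ≈⟨ +-congʳ (-‿inverseˡ y) ⟩
    0# + (x - z)         ≈⟨ +-identityˡ _ ⟩
    x - z                ∎

  -- In terms of the outermost Horner step y = c₀ + (x - η₀) y′,
  -- (x - a) y = (η₀ - a) c₀ + (x - η₀) (c₀ + (x - a) y′).
  Span-step : ∀ {p} {Q : ℕ → Carrier → Set p} → IsFiltration Q →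
              ∀ k {η x y} a → Span (Q ∘ suc) k η x y →
              Span Q (suc k) η x ((x - con a) * y)
  Span-step F zero {η} {x} a (span _ _ y≈0) =
    Span-resp (sym (trans (*-congˡ y≈0) (zeroʳ _))) (Span-zero F 1 η x)
  Span-step F (suc k) {η} {x} {y} a (span c c∈ y≈) = Span-resp eq
    (cons (scale (η 0 K.- a) (down (c∈ 0)))
      (Span-sum F′ (Span-const F′ k (η ∘ suc) x (c∈ 0))
        (Span-step F′ k a (span (c ∘ suc) (c∈ ∘ suc) refl))))
    where
    open IsFiltration F
    F′ = tail-isFiltration F
    y′ = horner k (c ∘ suc) (η ∘ suc) x
    eq : con (η 0 K.- a) * c 0 + (x - con (η 0)) * (c 0 + (x - con a) * y′) ≈
         (x - con a) * y
    eq = begin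
      con (η 0 K.- a) * c 0 + (x - con (η 0)) * (c 0 + (x - con a) * y′)
        ≈⟨ +-congʳ (*-congʳ (con-- (η 0) a)) ⟩
      (con (η 0) - con a) * c 0 + (x - con (η 0)) * (c 0 + (x - con a) * y′)
        ≈⟨ solve 5 (λ d e f c y → d :* c :+ e :* (c :+ f :* y) := (e :+ d) :* c :+ f :* (e :* y))
             refl (con (η 0) - con a) (x - con (η 0)) (x - con a) (c 0) y′ ⟩
      ((x - con (η 0)) + (con (η 0) - con a)) * c 0 + (x - con a) * ((x - con (η 0)) * y′)
        ≈⟨ +-congʳ (*-congʳ (x-y+y-z≈x-z _ _ _)) ⟩
      (x - con a) * c 0 + (x - con a) * ((x - con (η 0)) * y′)
        ≈⟨ distribˡ _ _ _ ⟨
      (x - con a) * (c 0 + (x - con (η 0)) * y′)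
        ≈⟨ *-congˡ y≈ ⟨
      (x - con a) * y ∎

  -- In `c₀ + (x - η₀) y′` the inner part `y′` is rewritten by induction, and `Span-step` absorbs
  -- the factor `x - η₀`. A coefficient contributes only to its own index and smaller ones, where
  -- the filtration is weaker.
  Span-change : ∀ {p} {Q : ℕ → Carrier → Set p} → IsFiltration Q →
                ∀ k {η x y} η′ → Span Q k η x y → Span Q k η′ x y
  Span-change F zero    η′ (span c c∈ y≈) = span c c∈ y≈
  Span-change F (suc k) {η} {x} η′ (span c c∈ y≈) = Span-resp (sym y≈)
    (Span-sum F (Span-const F k η′ x (c∈ 0))
      (Span-step F k (η 0)
        (Span-change (tail-isFiltration F) k η′ (span (c ∘ suc) (c∈ ∘ suc) refl))))

  newton∈Span : ∀ {p} {Q : ℕ → Carrier → Set p} → IsFiltration Q → (∀ i → Q i 1#) →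
                ∀ k η η′ x → Span Q (suc k) η′ x (newton k η x)
  newton∈Span F 1∈ zero    η η′ x = Span-const F 0 η′ x (1∈ 0)
  newton∈Span F 1∈ (suc k) η η′ x =
    Span-step F (suc k) (η 0)
      (newton∈Span (tail-isFiltration F) (1∈ ∘ suc) k (η ∘ suc) η′ x)

  Constant : ℕ → Carrier → Set (c ⊔ ρ)
  Constant _ y = ∃[ a ] y ≈ con a

  Constant-isFiltration : IsFiltration Constant
  Constant-isFiltration = record
    { resp  = λ x≈y (a , x≈a) → a , trans (sym x≈y) x≈a
    ; zero∈ = K.0# , sym C.0#-homo
    ; sum∈  = λ (a , x≈a) (b , y≈b) →
        a K.+ b , trans (+-cong x≈a y≈b) (sym (C.+-homo a b))
    ; scale = λ s (a , x≈a) → s K.* a , trans (*-congˡ x≈a) (sym (C.*-homo s a))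
    ; down  = id
    }

  -- Expansions in several variables.

  module _ (q : ℕ) where

    -- The combination of the products over `j` of `newton (m j) (η j) (x j)` with coefficients
    -- `a m`, nested variable by variable. Coefficients are given at all vectors, which makes
    -- translation free of bounds, but only entries below `q` are read.
    lin : ∀ {n} → (Fin n → ℕ → K.Carrier) → (Fin n → Carrier) →
          (Vec ℕ n → K.Carrier) → Carrier
    lin {zero}  η x a = con (a [])
    lin {suc n} η x a =
      horner q (λ i → lin (η ∘ suc) (x ∘ suc) (a ∘ (i ∷_))) (η zero) (x zero)

    lin-cong : ∀ {n} η (x : Fin n → Carrier) {a a′} →
               (∀ {m} → All (_< q) m → a m K.≈ a′ m) → lin η x a ≈ lin η x a′
    lin-cong {zero}  η x a≈ = C.⟦⟧-cong (a≈ [])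
    lin-cong {suc n} η x a≈ = horner-cong q (η zero) (x zero) λ i<q →
      lin-cong (η ∘ suc) (x ∘ suc) (a≈ ∘ (i<q ∷_))

    lin-zero : ∀ {n} η (x : Fin n → Carrier) {a} →
               (∀ m → a m K.≈ K.0#) → lin η x a ≈ 0#
    lin-zero {zero}  η x a≈0 = trans (C.⟦⟧-cong (a≈0 [])) C.0#-homo
    lin-zero {suc n} η x a≈0 = horner-zero q (η zero) (x zero) λ {i} _ →
      lin-zero (η ∘ suc) (x ∘ suc) (a≈0 ∘ (i ∷_))

    lin-sum : ∀ {n} η (x : Fin n → Carrier) a a′ →
              lin η x (λ m → a m K.+ a′ m) ≈ lin η x a + lin η x a′
    lin-sum {zero}  η x a a′ = C.+-homo _ _
    lin-sum {suc n} η x a a′ = trans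
      (horner-cong q (η zero) (x zero) λ _ → lin-sum (η ∘ suc) (x ∘ suc) _ _)
      (horner-sum q _ _ (η zero) (x zero))

    lin-scale : ∀ {n} η (x : Fin n → Carrier) s a →
                lin η x (λ m → s K.* a m) ≈ con s * lin η x a
    lin-scale {zero}  η x s a = C.*-homo _ _
    lin-scale {suc n} η x s a = trans
      (horner-cong q (η zero) (x zero) λ _ → lin-scale (η ∘ suc) (x ∘ suc) s _)
      (horner-scale q (con s) _ (η zero) (x zero))

    -- Total degree below `d`, measured in the Newton basis at `η`. With a strict bound the zero
    -- element needs no separate case: it is described by `d = 0`.
    LinBelow : ∀ {n} → (Fin n → ℕ → K.Carrier) → (Fin n → Carrier) → ℕ → Carrier →
               Set (c ⊔ ℓ ⊔ ρ)
    LinBelow η x d y =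
      ∃[ a ] ((∀ m → d ≤ Vec.sum m → a m K.≈ K.0#) × y ≈ lin η x a)

    -- Exponent `i` in a preceding variable leaves degree below `d ∸ i`. Truncated subtraction is
    -- right here: for `i ≥ d` the coefficient has to be zero.
    LinBelow-isFiltration : ∀ {n} η (x : Fin n → Carrier) d →
                            IsFiltration (λ i → LinBelow η x (d ∸ i))
    LinBelow-isFiltration η x d = record
      { resp  = λ y≈z (a , a≈0 , y≈) → a , a≈0 , trans (sym y≈z) y≈
      ; zero∈ = const K.0# , (λ _ _ → K.refl) , sym (lin-zero η x (λ _ → K.refl))
      ; sum∈  = λ (a , a≈0 , y≈) (a′ , a′≈0 , z≈) →
          (λ m → a m K.+ a′ m) ,
          (λ m d≤ → K.trans (K.+-cong (a≈0 m d≤) (a′≈0 m d≤)) (K.+-identityˡ K.0#)) ,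
          trans (+-cong y≈ z≈) (sym (lin-sum η x a a′))
      ; scale = λ s (a , a≈0 , y≈) →
          (λ m → s K.* a m) ,
          (λ m d≤ → K.trans (K.*-congˡ (a≈0 m d≤)) (K.zeroʳ s)) ,
          trans (*-congˡ y≈) (sym (lin-scale η x s a))
      ; down  = λ {i} (a , a≈0 , y≈) →
          a , (λ m d≤ → a≈0 m (ℕ.≤-trans (ℕ.∸-monoʳ-≤ d (ℕ.n≤1+n i)) d≤)) , y≈
      }

    -- The points are changed in every coefficient first, by induction on the number of variables,
    -- and then in the first variable by `Span-change`, whose filtration records the degree left.
    LinBelow-change : ∀ {n} {η} η′ {x : Fin n → Carrier} {d y} →
                      LinBelow η x d y → LinBelow η′ x d y
    LinBelow-change {zero}  η′ y∈ = y∈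
    LinBelow-change {suc n} {η} η′ {x} {d} (a , a≈0 , y≈) =
      let span c c∈ y≈′ = Span-change (LinBelow-isFiltration (η′ ∘ suc) (x ∘ suc) d) q (η′ zero)
            (span (λ i → lin (η ∘ suc) (x ∘ suc) (a ∘ (i ∷_)))
              (λ i → LinBelow-change (η′ ∘ suc)
                ( a ∘ (i ∷_)
                , (λ m d∸i≤ → a≈0 (i ∷ m)
                    (ℕ.≤-trans (ℕ.m≤n+m∸n d i) (ℕ.+-monoʳ-≤ i d∸i≤)))
                , refl))
              y≈)
      in (λ { (i ∷ m) → proj₁ (c∈ i) m })
       , (λ { (i ∷ m) d≤ → proj₁ (proj₂ (c∈ i)) m (ℕ.m≤n+o⇒m∸n≤o d i d≤) })
       , trans y≈′ (horner-cong q (η′ zero) (x zero) λ {i} _ → proj₂ (proj₂ (c∈ i)))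

    -- Translation of the coefficients by a vector, with zeros where the difference would have a
    -- negative entry.
    delayᵛ : ∀ {n} → Vec ℕ n → (Vec ℕ n → K.Carrier) → Vec ℕ n → K.Carrier
    delayᵛ []      a []      = a []
    delayᵛ (k ∷ k⃗) a (i ∷ m) = delay (const K.0#) k (λ i → delayᵛ k⃗ (a ∘ (i ∷_))) i m

    delayᵛ-+ : ∀ {n} (k : Vec ℕ n) a m → delayᵛ k a (k +ᵛ m) ≡ a m
    delayᵛ-+ []      a []      = ≡.refl
    delayᵛ-+ (k ∷ k⃗) a (i ∷ m) = ≡.trans (delay-+ k i) (delayᵛ-+ k⃗ (a ∘ (i ∷_)) m)
      where
      delay-+ : ∀ k i →
                delay (const K.0#) k (λ i → delayᵛ k⃗ (a ∘ (i ∷_))) (k ℕ.+ i) (k⃗ +ᵛ m) ≡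
                delayᵛ k⃗ (a ∘ (i ∷_)) (k⃗ +ᵛ m)
      delay-+ zero    i = ≡.refl
      delay-+ (suc k) i = delay-+ k i

    -- If `m` is not of the form `k +ᵛ m′`, the hypothesis is empty and the value is a zero inserted
    -- by `delay`.
    delayᵛ-zero : ∀ {n} (k : Vec ℕ n) a m →
                  (∀ m′ → m ≡ k +ᵛ m′ → a m′ K.≈ K.0#) → delayᵛ k a m K.≈ K.0#
    delayᵛ-zero []      a []      a≈0 = a≈0 [] ≡.refl
    delayᵛ-zero (k ∷ k⃗) a (i ∷ m) a≈0 = go k i λ i′ i≡ →
      delayᵛ-zero k⃗ (a ∘ (i′ ∷_)) m λ m′ m≡ → a≈0 (i′ ∷ m′) (≡.cong₂ _∷_ i≡ m≡)
      where
      go : ∀ k i → (∀ i′ → i ≡ k ℕ.+ i′ → delayᵛ k⃗ (a ∘ (i′ ∷_)) m K.≈ K.0#) →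
           delay (const K.0#) k (λ i → delayᵛ k⃗ (a ∘ (i ∷_))) i m K.≈ K.0#
      go zero    i       h = h i ≡.refl
      go (suc k) zero    h = K.refl
      go (suc k) (suc i) h = go k i (λ i′ i≡ → h i′ (≡.cong suc i≡))

    newtonᵛ : ∀ {n} → Vec ℕ n → (Fin n → ℕ → K.Carrier) → (Fin n → Carrier) → Carrier
    newtonᵛ []      η x = 1#
    newtonᵛ (k ∷ k⃗) η x = newton k (η zero) (x zero) * newtonᵛ k⃗ (η ∘ suc) (x ∘ suc)

    -- The points dropped from each variable are those supplied by the factors of `newtonᵛ k η`.
    shift : ∀ {n} → Vec ℕ n → (Fin n → ℕ → K.Carrier) → Fin n → ℕ → K.Carrier
    shift k η j i = η j (Vec.lookup k j ℕ.+ i)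

    -- The factor `N` of the later variables is a scalar for the expansion in the first one, so it
    -- moves into the coefficients, where the induction hypothesis applies. The first variable is
    -- then `horner-annihilated`.
    lin-delay : ∀ {n} (k : Vec ℕ n) η (x : Fin n → Carrier) a →
                (∀ j → newton q (η j) (x j) ≈ 0#) →
                newtonᵛ k η x * lin (shift k η) x a ≈ lin η x (delayᵛ k a)
    lin-delay []      η x a N≈0 = *-identityˡ _
    lin-delay (k ∷ k⃗) η x a N≈0 = begin
      newton k η₀ x₀ * N * horner q (λ i → lin _ _ (a ∘ (i ∷_))) (η₀ ∘ (k ℕ.+_)) x₀
        ≈⟨ *-assoc _ _ _ ⟩
      newton k η₀ x₀ * (N * horner q (λ i → lin _ _ (a ∘ (i ∷_))) (η₀ ∘ (k ℕ.+_)) x₀)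
        ≈⟨ *-congˡ (horner-scale q N _ _ x₀) ⟨
      newton k η₀ x₀ * horner q (λ i → N * lin _ _ (a ∘ (i ∷_))) (η₀ ∘ (k ℕ.+_)) x₀
        ≈⟨ *-congˡ (horner-cong q _ x₀ λ {i} _ →
             lin-delay k⃗ (η ∘ suc) (x ∘ suc) (a ∘ (i ∷_)) (N≈0 ∘ suc)) ⟩
      newton k η₀ x₀ * horner q (λ i → lin (η ∘ suc) (x ∘ suc) (A i)) (η₀ ∘ (k ℕ.+_)) x₀
        ≈⟨ horner-annihilated k q _ η₀ x₀ (N≈0 zero) ⟩
      horner q (delay 0# k (λ i → lin (η ∘ suc) (x ∘ suc) (A i))) η₀ x₀
        ≈⟨ horner-cong q η₀ x₀ (λ {i} _ → lin-delay₁ k i) ⟩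
      horner q (λ i → lin (η ∘ suc) (x ∘ suc) (delay (const K.0#) k A i)) η₀ x₀ ∎
      where
      η₀ = η zero
      x₀ = x zero
      N  = newtonᵛ k⃗ (η ∘ suc) (x ∘ suc)
      A  = λ i → delayᵛ k⃗ (a ∘ (i ∷_))
      lin-delay₁ : ∀ k {A} i → delay 0# k (λ i → lin (η ∘ suc) (x ∘ suc) (A i)) i ≈
                   lin (η ∘ suc) (x ∘ suc) (delay (const K.0#) k A i)
      lin-delay₁ zero    i       = refl
      lin-delay₁ (suc k) zero    = sym (lin-zero (η ∘ suc) (x ∘ suc) (λ _ → K.refl))
      lin-delay₁ (suc k) (suc i) = lin-delay₁ k i

-- Uniqueness of Newton coefficients over a field.

module FieldProperties {c ℓ} (F : Field c ℓ) where
  open Field F hiding (zero)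
  open import Algebra.Properties.AbelianGroup +-abelianGroup using (∙-cancelˡ)
  open import Algebra.Properties.Group +-group using (x∙y⁻¹≈ε⇒x≈y)
  open import Relation.Binary.Reasoning.Setoid setoid

  *-cancelˡ-≉0 : ∀ {x y z} → ¬ x ≈ 0# → x * y ≈ x * z → y ≈ z
  *-cancelˡ-≉0 {x} {y} {z} x≉0 xy≈xz = begin
    y              ≈⟨ undo y ⟨
    x⁻¹ * (x * y)  ≈⟨ *-congˡ xy≈xz ⟩
    x⁻¹ * (x * z)  ≈⟨ undo z ⟩
    z              ∎
    where
    x⁻¹ = proj₁ (inverse x x≉0)
    undo : ∀ w → x⁻¹ * (x * w) ≈ w
    undo w = begin
      x⁻¹ * (x * w)  ≈⟨ *-assoc x⁻¹ x w ⟨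
      x⁻¹ * x * w    ≈⟨ *-congʳ (trans (*-comm x⁻¹ x) (proj₂ (inverse x x≉0))) ⟩
      1# * w         ≈⟨ *-identityˡ w ⟩
      w              ∎

  open Newton commutativeRing commutativeRing id (isRingHomomorphism rawRing refl)

  DistinctBelow : ℕ → (ℕ → Carrier) → Set ℓ
  DistinctBelow k η = ∀ {i l} → i < l → l < k → ¬ η l ≈ η i

  -- Evaluation at `η 0` isolates `c 0`. At a later point `η l` the common constant and the nonzero
  -- factor `η l - η 0` cancel, which leaves expansions at the remaining points.
  horner-injective : ∀ k {η} → DistinctBelow k η → ∀ {c c′} →
                     (∀ {l} → l < k → horner k c η (η l) ≈ horner k c′ η (η l)) →
                     ∀ {i} → i < k → c i ≈ c′ i
  horner-injective (suc k) {η} distinct {c} {c′} agree = go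
    where
    at-η₀ : ∀ c → horner (suc k) c η (η 0) ≈ c 0
    at-η₀ c = trans (+-congˡ (trans (*-congʳ (-‿inverseʳ (η 0))) (zeroˡ _))) (+-identityʳ _)
    c₀≈c′₀ : c 0 ≈ c′ 0
    c₀≈c′₀ = trans (sym (at-η₀ c)) (trans (agree z<s) (at-η₀ c′))
    go : ∀ {i} → i < suc k → c i ≈ c′ i
    go {zero}  _         = c₀≈c′₀
    go {suc i} (s<s i<k) = horner-injective k
      (λ i<l l<k → distinct (s<s i<l) (s<s l<k))
      (λ l<k → *-cancelˡ-≉0 (distinct z<s (s<s l<k) ∘ x∙y⁻¹≈ε⇒x≈y _ _)
        (∙-cancelˡ (c 0) _ _ (trans (agree (s<s l<k)) (+-congʳ (sym c₀≈c′₀)))))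
      i<k

  -- With the later variables fixed, the first one runs through its points; `horner-injective` then
  -- identifies the coefficients, which are expansions in the later variables.
  lin-injective : ∀ q {n} {η : Fin n → ℕ → Carrier} → (∀ j → DistinctBelow q (η j)) →
                  ∀ {a a′} → (∀ x → lin q η x a ≈ lin q η x a′) →
                  ∀ {m} → All (_< q) m → a m ≈ a′ m
  lin-injective q         distinct agree []          = agree (λ ())
  lin-injective q {η = η} distinct agree (i<q ∷ m<q) = lin-injective q (distinct ∘ suc)
    (λ x → horner-injective q (distinct zero) (λ {l} _ → agree (η zero l Vector.∷ x)) i<q) m<q

-- Fermat's theorem in a finite field.

module FiniteField {c ℓ} (F : Field c ℓ) (q : ℕ) (ξ : Ordering q (Field.setoid F)) where
  open Field F hiding (zero)
  open FieldProperties F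
  open ReducedPolynomials F q ξ using (index; _≟_)
  open import Algebra.Properties.CommutativeMonoid.Sum *-commutativeMonoid
    using (sum-remove; sum-permute; ∑-distrib-+; sum-cong-≋; sum-replicate)
    renaming (sum to product)
  open import Algebra.Properties.Semiring.Exp semiring using (_^_)
  open import Relation.Binary.Reasoning.Setoid setoid
  private module I = Inverse index

  -- In `fermat` the exceptional index is that of zero, and the additional factor `x` makes up for
  -- the missing one, which avoids the exponent `q - 1`.
  product-replace : ∀ {n} (g : Fin n → Carrier) x i → g i ≈ 1# → (∀ j → j ≢ i → g j ≈ x) →
                    x * product g ≈ x ^ n
  product-replace {suc n} g x i gᵢ≈1 g≈x = *-congˡ (begin
    product g                            ≈⟨ sum-remove {i = i} g ⟩
    g i * product (Vector.removeAt g i)  ≈⟨ *-cong gᵢ≈1 (sum-cong-≋ λ j → g≈x _ (Fin.punchInᵢ≢i i j)) ⟩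
    1# * product (Vector.replicate n x)  ≈⟨ *-identityˡ _ ⟩
    product (Vector.replicate n x)       ≈⟨ sum-replicate n ⟩
    x ^ n                                ∎)

  product-≉0 : ∀ {n} (g : Fin n → Carrier) → (∀ i → ¬ g i ≈ 0#) → ¬ product g ≈ 0#
  product-≉0 {zero}  g g≉0 = 1≉0
  product-≉0 {suc n} g g≉0 = λ gΠ≈0 → product-≉0 (g ∘ suc) (g≉0 ∘ suc)
    (*-cancelˡ-≉0 (g≉0 zero) (trans gΠ≈0 (sym (zeroʳ _))))

  select : Carrier → Carrier → Carrier → Carrier
  select y z w with y ≟ 0#
  ... | yes _ = z
  ... | no  _ = w

  select-≈0 : ∀ {y} z w → y ≈ 0# → select y z w ≈ z
  select-≈0 {y} z w y≈0 with y ≟ 0#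
  ... | yes _   = refl
  ... | no  y≉0 = contradiction y≈0 y≉0

  select-≉0 : ∀ {y} z w → ¬ y ≈ 0# → select y z w ≈ w
  select-≉0 {y} z w y≉0 with y ≟ 0#
  ... | yes y≈0 = contradiction y≈0 y≉0
  ... | no  _   = refl

  ^-≈0 : ∀ n .{{_ : NonZero n}} {x} → x ≈ 0# → x ^ n ≈ x
  ^-≈0 (suc n) x≈0 = trans (*-congʳ x≈0) (trans (zeroˡ _) (sym x≈0))

  scaling : ∀ x → ¬ x ≈ 0# → Permutation′ q
  scaling x x≉0 = permutation (times x) (times x⁻¹)
    (times-times xx⁻¹≈1) (times-times (trans (*-comm _ _) xx⁻¹≈1))
    where
    x⁻¹ = proj₁ (inverse x x≉0)
    xx⁻¹≈1 = proj₂ (inverse x x≉0)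
    times : Carrier → Fin q → Fin q
    times y i = I.to (y * I.from i)
    times-times : ∀ {y z} → z * y ≈ 1# → ∀ i → times z (times y i) ≡ i
    times-times {y} {z} zy≈1 i = ≡.trans (I.to-cong (begin
      z * I.from (I.to (y * I.from i))  ≈⟨ *-congˡ (I.strictlyInverseʳ _) ⟩
      z * (y * I.from i)                ≈⟨ *-assoc z y _ ⟨
      z * y * I.from i                  ≈⟨ *-congʳ zy≈1 ⟩
      1# * I.from i                     ≈⟨ *-identityˡ _ ⟩
      I.from i                          ∎)) (I.strictlyInverseˡ i)

  -- Multiplication by x ≉ 0 permutes the field, and so fixes the product of
  -- all its nonzero elements (select y 1# y replaces the factor 0 by 1).
  fermat : ∀ x → x ^ q ≈ x
  fermat x with x ≟ 0#
  ... | yes x≈0 = ^-≈0 q {{Fin.nonZeroIndex (I.to 0#)}} x≈0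
  ... | no  x≉0 = begin
    x ^ q               ≈⟨ product-replace factor x (I.to 0#)
                             (select-≈0 1# x (I.strictlyInverseʳ 0#))
                             (λ j j≢ → select-≉0 1# x λ ξⱼ≈0 → j≢
                               (≡.trans (≡.sym (I.strictlyInverseˡ j)) (I.to-cong ξⱼ≈0))) ⟨
    x * product factor  ≈⟨ *-congˡ (*-cancelˡ-≉0 (product-≉0 nonzero nonzero-≉0) (begin
      product nonzero * product factor           ≈⟨ ∑-distrib-+ nonzero factor ⟨
      product (λ i → nonzero i * factor i)       ≈⟨ sum-cong-≋ scaled ⟨
      product (nonzero ∘ (scaling x x≉0 ⟨$⟩ʳ_))  ≈⟨ sum-permute nonzero (scaling x x≉0) ⟨
      product nonzero                            ≈⟨ *-identityʳ _ ⟨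
      product nonzero * 1#                       ∎)) ⟩
    x * 1#              ≈⟨ *-identityʳ x ⟩
    x                   ∎
    where
    factor nonzero : Fin q → Carrier
    factor  i = select (I.from i) 1# x
    nonzero i = select (I.from i) 1# (I.from i)

    nonzero-≉0 : ∀ i → ¬ nonzero i ≈ 0#
    nonzero-≉0 i with I.from i ≟ 0#
    ... | yes _   = 1≉0
    ... | no  y≉0 = y≉0

    scaled : ∀ i → nonzero (scaling x x≉0 ⟨$⟩ʳ i) ≈ nonzero i * factor i
    scaled i with I.from i ≟ 0#
    ... | yes y≈0 = trans
      (select-≈0 _ _ (trans (I.strictlyInverseʳ _) (trans (*-congˡ y≈0) (zeroʳ x))))
      (sym (*-identityˡ 1#))
    ... | no y≉0 = trans
      (select-≉0 _ _ λ xy≈0 → y≉0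
        (*-cancelˡ-≉0 x≉0 (trans (sym (I.strictlyInverseʳ _)) (trans xy≈0 (sym (zeroʳ x))))))
      (trans (I.strictlyInverseʳ _) (*-comm x _))

-- The quotient ring and evaluation at points.

module QuotientRing {c ℓ} (F : Field c ℓ) (q : ℕ) (ξ : Ordering q (Field.setoid F)) where
  private module F = Field F
  open FieldProperties F
  open FiniteField F q ξ using (fermat)
  open ReducedPolynomials F q ξ

  𝒫-commutativeRing : ℕ → CommutativeRing c (c ⊔ ℓ)
  𝒫-commutativeRing n = record
    { Carrier = Poly n
    ; _≈_ = _≈ₚ_
    ; _+_ = _+ₚ_
    ; _*_ = _*ₚ_
    ; -_ = -ₚ_
    ; 0# = con F.0#
    ; 1# = con F.1#
    ; isCommutativeRing = record
      { isRing = record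
        { +-isAbelianGroup = record
          { isGroup = record
            { isMonoid = record
              { isSemigroup = record
                { isMagma = record
                  { isEquivalence = Setoid.isEquivalence (𝒫 n) ; ∙-cong = +-cong }
                ; assoc = +-assoc }
              ; identity = comm∧idˡ⇒id +-comm +-identityˡ }
            ; inverse = comm∧invˡ⇒inv +-comm -‿inverseˡ
            ; ⁻¹-cong = -‿cong }
          ; comm = +-comm }
        ; *-cong = *-cong
        ; *-assoc = *-assoc
        ; *-identity = comm∧idˡ⇒id *-comm *-identityˡ
        ; distrib = comm∧distrˡ⇒distr +-cong *-comm distribˡ }
      ; *-comm = *-comm } }
    where open import Algebra.Consequences.Setoid (𝒫 n)

  module _ {n : ℕ} where
    open CommutativeRing (𝒫-commutativeRing n) using (+-group; rawRing)
    open import Algebra.Properties.Group +-group using (inverseˡ-unique)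
    open Morphism.RingMorphisms F.rawRing rawRing

    con-isRingHomomorphism : IsRingHomomorphism con
    con-isRingHomomorphism = record
      { isSemiringHomomorphism = record
        { isNearSemiringHomomorphism = record
          { +-isMonoidHomomorphism = record
            { isMagmaHomomorphism = record
              { isRelHomomorphism = record { cong = con-cong }
              ; homo = con-+ }
            ; ε-homo = reflₚ }
          ; *-homo = con-* }
        ; 1#-homo = reflₚ }
      ; -‿homo = λ k → inverseˡ-unique (con (F.- k)) (con k)
          (transₚ (symₚ (con-+ (F.- k) k)) (con-cong (F.-‿inverseˡ k))) }

  open import Algebra.Properties.Semiring.Exp F.semiring using (_^_)

  eval : ∀ {n} → (Fin n → F.Carrier) → Poly n → F.Carrier
  eval ρ (con k)  = k
  eval ρ (X i)    = ρ i
  eval ρ (x +ₚ y) = eval ρ x F.+ eval ρ y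
  eval ρ (x *ₚ y) = eval ρ x F.* eval ρ y
  eval ρ (-ₚ x)   = F.- eval ρ x

  eval-^ : ∀ {n} (ρ : Fin n → F.Carrier) x k → eval ρ (x ^ₚ k) ≡ eval ρ x ^ k
  eval-^ ρ x zero    = ≡.refl
  eval-^ ρ x (suc k) = ≡.cong (eval ρ x F.*_) (eval-^ ρ x k)

  -- Evaluation descends to the quotient because `fermat` validates the relation `X^q≈X`; the
  -- remaining cases are laws of the field.
  eval-cong : ∀ {n} (ρ : Fin n → F.Carrier) {x y} → x ≈ₚ y → eval ρ x F.≈ eval ρ y
  eval-cong ρ reflₚ                = F.refl
  eval-cong ρ (symₚ x≈y)           = F.sym (eval-cong ρ x≈y)
  eval-cong ρ (transₚ x≈y y≈z)     = F.trans (eval-cong ρ x≈y) (eval-cong ρ y≈z)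
  eval-cong ρ (+-cong x≈y z≈w)     = F.+-cong (eval-cong ρ x≈y) (eval-cong ρ z≈w)
  eval-cong ρ (*-cong x≈y z≈w)     = F.*-cong (eval-cong ρ x≈y) (eval-cong ρ z≈w)
  eval-cong ρ (-‿cong x≈y)         = F.-‿cong (eval-cong ρ x≈y)
  eval-cong ρ (+-assoc x y z)      = F.+-assoc _ _ _
  eval-cong ρ (+-comm x y)         = F.+-comm _ _
  eval-cong ρ (+-identityˡ x)      = F.+-identityˡ _
  eval-cong ρ (-‿inverseˡ x)       = F.-‿inverseˡ _
  eval-cong ρ (*-assoc x y z)      = F.*-assoc _ _ _
  eval-cong ρ (*-comm x y)         = F.*-comm _ _
  eval-cong ρ (*-identityˡ x)      = F.*-identityˡ _
  eval-cong ρ (distribˡ x y z)     = F.distribˡ _ _ _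
  eval-cong ρ (con-cong k≈l)       = k≈l
  eval-cong ρ (con-+ k l)          = F.refl
  eval-cong ρ (con-* k l)          = F.refl
  eval-cong ρ (X^q≈X i)            =
    F.trans (F.reflexive (eval-^ ρ (X i) q)) (fermat (ρ i))

  module P {n} = Newton F.commutativeRing (𝒫-commutativeRing n) con con-isRingHomomorphism
  private
    module N = Newton F.commutativeRing F.commutativeRing id
      (isRingHomomorphism F.rawRing F.refl)

  eval-newton : ∀ {n} (ρ : Fin n → F.Carrier) k η x →
                eval ρ (P.newton k η x) ≡ N.newton k η (eval ρ x)
  eval-newton ρ zero    η x = ≡.refl
  eval-newton ρ (suc k) η x = ≡.cong (_ F.*_) (eval-newton ρ k (η ∘ suc) x)

  eval-horner : ∀ {n} (ρ : Fin n → F.Carrier) k c η x →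
                eval ρ (P.horner k c η x) ≡ N.horner k (eval ρ ∘ c) η (eval ρ x)
  eval-horner ρ zero    c η x = ≡.refl
  eval-horner ρ (suc k) c η x =
    ≡.cong (λ z → _ F.+ _ F.* z) (eval-horner ρ k (c ∘ suc) (η ∘ suc) x)

  eval-lin : ∀ {n k} (ρ : Fin n → F.Carrier) η (x : Fin k → Poly n) a →
             eval ρ (P.lin q η x a) F.≈ N.lin q η (eval ρ ∘ x) a
  eval-lin {k = zero}  ρ η x a = F.refl
  eval-lin {k = suc k} ρ η x a = F.trans
    (F.reflexive (eval-horner ρ q _ (η zero) (x zero)))
    (N.horner-cong q (η zero) _ λ {i} _ → eval-lin ρ (η ∘ suc) (x ∘ suc) (a ∘ (i ∷_)))

  -- The listing is continued periodically, so that `q` consecutive points are distinct wherever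
  -- they start.
  ξ̃ : ℕ → F.Carrier
  ξ̃ i = Bijection.to ξ (i mod q)

  -- Adding `q ∸ k` and reducing modulo `q` undoes the addition of `k`.
  %-injective : ∀ {k i l} → k ≤ q → i < q → l < q → (k ℕ.+ i) % q ≡ (k ℕ.+ l) % q → i ≡ l
  %-injective {k} {i} {l} k≤q i<q l<q eq = begin
    i                            ≡⟨ undo i<q ⟨
    (q ∸ k ℕ.+ (k ℕ.+ i) % q) % q  ≡⟨ ≡.cong (λ z → (q ∸ k ℕ.+ z) % q) eq ⟩
    (q ∸ k ℕ.+ (k ℕ.+ l) % q) % q  ≡⟨ undo l<q ⟩
    l                            ∎
    where
    open ≡.≡-Reasoning
    undo : ∀ {i} → i < q → (q ∸ k ℕ.+ (k ℕ.+ i) % q) % q ≡ i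
    undo {i} i<q = begin
      (q ∸ k ℕ.+ (k ℕ.+ i) % q) % q          ≡⟨ ℕ.%-distribˡ-+ (q ∸ k) _ q ⟩
      ((q ∸ k) % q ℕ.+ (k ℕ.+ i) % q % q) % q  ≡⟨ ≡.cong (λ z → ((q ∸ k) % q ℕ.+ z) % q)
                                                    (ℕ.m%n%n≡m%n (k ℕ.+ i) q) ⟩
      ((q ∸ k) % q ℕ.+ (k ℕ.+ i) % q) % q      ≡⟨ ℕ.%-distribˡ-+ (q ∸ k) _ q ⟨
      (q ∸ k ℕ.+ (k ℕ.+ i)) % q              ≡⟨ ≡.cong (_% q) (ℕ.+-assoc (q ∸ k) k i) ⟨
      (q ∸ k ℕ.+ k ℕ.+ i) % q                ≡⟨ ≡.cong (λ z → (z ℕ.+ i) % q) (ℕ.m∸n+n≡m k≤q) ⟩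
      (q ℕ.+ i) % q                          ≡⟨ ≡.cong (_% q) (ℕ.+-comm q i) ⟩
      (i ℕ.+ q) % q                          ≡⟨ ℕ.[m+n]%n≡m%n i q ⟩
      i % q                                  ≡⟨ ℕ.m<n⇒m%n≡m i<q ⟩
      i                                      ∎

  shifted-distinct : ∀ {k} → k ≤ q → DistinctBelow q (ξ̃ ∘ (k ℕ.+_))
  shifted-distinct {k} k≤q {i} {l} i<l l<q ξl≈ξi = ℕ.<⇒≢ i<l (≡.sym
    (%-injective k≤q l<q (ℕ.<-trans i<l l<q)
      (Fin.fromℕ<-injective _ _ (ℕ.m%n<n _ q) (ℕ.m%n<n _ q) (Bijection.injective ξ ξl≈ξi))))

-- Reduction modulo `X^q - X` in one variable.

module Degrees {c ℓ} (F : Field c ℓ) (q : ℕ) (ξ : Ordering q (Field.setoid F)) where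
  private module F = Field F
  open FieldProperties F
  open ReducedPolynomials F q ξ
  open QuotientRing F q ξ
  private
    module N = Newton F.commutativeRing F.commutativeRing id
      (isRingHomomorphism F.rawRing F.refl)

  module _ {n : ℕ} where
    open CommutativeRing (𝒫-commutativeRing n)
      using (+-congˡ; *-congˡ; *-congʳ; +-identityʳ; *-identityʳ; zeroʳ; _-_; reflexive;
             setoid; ring; commutativeSemiring)
    open import Algebra.Properties.Ring ring using (-0#≈0#)
    open import Relation.Binary.Reasoning.Setoid setoid
    open import Algebra.Solver.Ring.NaturalCoefficients.Default commutativeSemiring
      using (solve; _:*_; _:=_)
    open P {n} using (newton; horner; newtonᵛ; lin; Span; span; Constant;
      Constant-isFiltration; Span-change; Span-resp; Span-sum; Span-const; cons;
      newton∈Span; horner-+; horner-cong; horner-zero; module IsFiltration)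

    x-0≈x : ∀ x → x - con F.0# ≈ₚ x
    x-0≈x x = transₚ (+-congˡ -0#≈0#) (+-identityʳ x)

    newton-0≈^ : ∀ k x → newton k (const F.0#) x ≈ₚ x ^ₚ k
    newton-0≈^ zero    x = reflₚ
    newton-0≈^ (suc k) x = *-cong (x-0≈x x) (newton-0≈^ k x)

    -- This is the leading term after `X^q` has been replaced by `X`; it sits at index 1, which has
    -- to be in range.
    scaled∈Span : ∀ {k} → 1 < k → ∀ x {a} → Constant 0 a →
                  Span Constant k (const F.0#) x (x *ₚ a)
    scaled∈Span {suc (suc k)} (s<s _) x a∈ = Span-resp
      (transₚ (+-identityˡ _) (*-congʳ (x-0≈x x)))
      (cons (IsFiltration.zero∈ Constant-isFiltration {0})
        (Span-const Constant-isFiltration k _ x a∈))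

    -- By X^q ≈ X, this product of degree q is a combination of the products of
    -- degree below q, whose coefficients vanish because it vanishes on F.
    newton-q≈0 : 1 < q → ∀ j → newton q ξ̃ (X j) ≈ₚ con F.0#
    newton-q≈0 1<q j = transₚ N≈ (horner-zero q ξ̃ x λ {i} i<q →
        transₚ (proj₂ (c∈ i)) (con-cong (coefficient≈0 i<q)))
      where
      x = X j
      reduced : Span Constant q ξ̃ x (newton q ξ̃ x)
      reduced with newton∈Span Constant-isFiltration (λ _ → F.1# , reflₚ) q ξ̃ (const F.0#) x
      ... | span c c∈ N≈ = Span-change Constant-isFiltration q ξ̃ (Span-resp (symₚ (begin
        newton q ξ̃ x
          ≈⟨ N≈ ⟩
        horner (suc q) c (const F.0#) x
          ≡⟨ ≡.cong (λ k → horner k c (const F.0#) x) (ℕ.+-comm 1 q) ⟩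
        horner (q ℕ.+ 1) c (const F.0#) x
          ≈⟨ horner-+ q 1 c (const F.0#) x ⟩
        horner q c (const F.0#) x +ₚ
        newton q (const F.0#) x *ₚ (c (q ℕ.+ 0) +ₚ (x - con F.0#) *ₚ con F.0#)
          ≈⟨ +-congˡ (*-cong (transₚ (newton-0≈^ q x) (X^q≈X j))
               (transₚ (+-congˡ (zeroʳ _)) (+-identityʳ _))) ⟩
        horner q c (const F.0#) x +ₚ x *ₚ c (q ℕ.+ 0) ∎))
        (Span-sum Constant-isFiltration (span c c∈ reflₚ) (scaled∈Span 1<q x (c∈ (q ℕ.+ 0)))))
      open Span reduced renaming (coefficient∈ to c∈; expansion to N≈)
      coefficient≈0 : ∀ {i} → i < q → proj₁ (c∈ i) F.≈ F.0#
      coefficient≈0 = horner-injective q (shifted-distinct z≤n) λ {l} l<q → F.sym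
        (F.trans (N.horner-zero q ξ̃ (ξ̃ l) (λ _ → F.refl))
        (F.trans (F.sym (N.newton-root q ξ̃ l<q))
        (F.trans (F.reflexive (≡.sym (eval-newton (const (ξ̃ l)) q ξ̃ x)))
        (F.trans (eval-cong (const (ξ̃ l)) (transₚ N≈ (horner-cong q ξ̃ x λ {i} _ → proj₂ (c∈ i))))
          (F.reflexive (eval-horner (const (ξ̃ l)) q _ ξ̃ x))))))

    -- The factors of f and the reduced polynomials as Newton expansions.

    ξ̃-toℕ : ∀ j → ξ̃ (toℕ j) ≡ Bijection.to ξ j
    ξ̃-toℕ j = ≡.cong (Bijection.to ξ) (Fin.toℕ-injective
      (≡.trans (Fin.toℕ-fromℕ< _) (ℕ.m<n⇒m%n≡m (Fin.toℕ<n j))))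

    b≡newton : ∀ {i} → i ≤ q → ∀ x → b i x ≡ newton i ξ̃ x
    b≡newton i≤q x = go i≤q ξ̃-toℕ
      where
      -- The listing is generalised to a family `t` extended by a sequence `s`, because the
      -- induction passes to the tails of both.
      go : ∀ {k i} → i ≤ k → {t : Fin k → F.Carrier} {s : ℕ → F.Carrier} → (∀ j → s (toℕ j) ≡ t j) →
           productₚ (List.map (λ k → x +ₚ (-ₚ con k)) (List.take i (List.tabulate t))) ≡ newton i s x
      go z≤n       s≡t = ≡.refl
      go (s≤s i≤k) s≡t = ≡.cong₂ (λ a y → (x - con a) *ₚ y) (≡.sym (s≡t zero)) (go i≤k (s≡t ∘ suc))

    product-b≡newtonᵛ : ∀ {k} (m : Vec ℕ k) → (∀ j → Vec.lookup m j ≤ q) → ∀ x →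
      productₚ (List.map (λ j → b (Vec.lookup m j) (x j)) (List.allFin k)) ≡
      newtonᵛ q m (const ξ̃) x
    product-b≡newtonᵛ m m≤q x =
      ≡.trans (≡.cong productₚ (List.map-tabulate id (λ j → b (Vec.lookup m j) (x j)))) (go m m≤q x)
      where
      go : ∀ {k} (m : Vec ℕ k) → (∀ j → Vec.lookup m j ≤ q) → ∀ x →
           productₚ (List.tabulate (λ j → b (Vec.lookup m j) (x j))) ≡ newtonᵛ q m (const ξ̃) x
      go []      m≤q x = ≡.refl
      go (k ∷ m) m≤q x =
        ≡.cong₂ _*ₚ_ (b≡newton (m≤q zero) (x zero)) (go m (m≤q ∘ suc) (x ∘ suc))

    sum-cong : ∀ {a} {A : Set a} {g h : A → Poly n} → (∀ i → g i ≈ₚ h i) → ∀ is →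
               sumₚ (List.map g is) ≈ₚ sumₚ (List.map h is)
    sum-cong g≈h []       = reflₚ
    sum-cong g≈h (i ∷ is) = +-cong (g≈h i) (sum-cong g≈h is)

    sum-scale : ∀ {a} {A : Set a} s (g : A → Poly n) is →
                sumₚ (List.map (λ i → s *ₚ g i) is) ≈ₚ s *ₚ sumₚ (List.map g is)
    sum-scale s g []       = symₚ (zeroʳ s)
    sum-scale s g (i ∷ is) = transₚ (+-congˡ (sum-scale s g is)) (symₚ (distribˡ s _ _))

    sum-++ : ∀ xs ys → sumₚ {n} (xs ++ ys) ≈ₚ sumₚ xs +ₚ sumₚ ys
    sum-++ []       ys = symₚ (+-identityˡ _)
    sum-++ (x ∷ xs) ys = transₚ (+-congˡ (sum-++ xs ys)) (symₚ (+-assoc _ _ _))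

    sum-product : ∀ {a b d} {A : Set a} {B : Set b} {D : Set d} (h : A → B → D) (g : D → Poly n) is ms →
      sumₚ (List.map g (List.cartesianProductWith h is ms)) ≈ₚ
      sumₚ (List.map (λ i → sumₚ (List.map (λ m → g (h i m)) ms)) is)
    sum-product h g []       ms = reflₚ
    sum-product h g (i ∷ is) ms = begin
      sumₚ (List.map g (List.map (h i) ms ++ rest))
        ≡⟨ ≡.cong sumₚ (List.map-++ g (List.map (h i) ms) rest) ⟩
      sumₚ (List.map g (List.map (h i) ms) ++ List.map g rest)
        ≈⟨ sum-++ (List.map g (List.map (h i) ms)) _ ⟩
      sumₚ (List.map g (List.map (h i) ms)) +ₚ sumₚ (List.map g rest)
        ≈⟨ +-cong (reflexive (≡.cong sumₚ (≡.sym (List.map-∘ ms)))) (sum-product h g is ms) ⟩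
      sumₚ (List.map (λ m → g (h i m)) ms) +ₚ _ ∎
      where
      rest = List.cartesianProductWith h is ms

    map-allFin-suc : ∀ {a} {A : Set a} k (h : Fin (suc k) → A) →
                     List.map h (List.allFin (suc k)) ≡ h zero ∷ List.map (h ∘ suc) (List.allFin k)
    map-allFin-suc k h = ≡.cong (h zero ∷_)
      (≡.trans (List.map-tabulate suc h) (≡.sym (List.map-tabulate id (h ∘ suc))))

    -- With all points zero the Newton form is Horner's scheme for powers: a factor `x` is taken out
    -- of every term but the first.
    horner-0 : ∀ k c x →
      sumₚ (List.map (λ i → x ^ₚ toℕ i *ₚ c (toℕ i)) (List.allFin k)) ≈ₚ horner k c (const F.0#) x
    horner-0 zero    c x = reflₚ
    horner-0 (suc k) c x = begin
      sumₚ (List.map g (List.allFin (suc k)))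
        ≡⟨ ≡.cong sumₚ (map-allFin-suc k g) ⟩
      con F.1# *ₚ c 0 +ₚ sumₚ (List.map (g ∘ suc) (List.allFin k))
        ≈⟨ +-cong (*-identityˡ _) (sum-cong (λ i → *-assoc x _ _) (List.allFin k)) ⟩
      c 0 +ₚ sumₚ (List.map (λ i → x *ₚ (x ^ₚ toℕ i *ₚ c (suc (toℕ i)))) (List.allFin k))
        ≈⟨ +-congˡ (transₚ (sum-scale x _ (List.allFin k)) (*-cong (symₚ (x-0≈x x)) (horner-0 k (c ∘ suc) x))) ⟩
      horner (suc k) c (const F.0#) x ∎
      where
      g : Fin (suc k) → Poly n
      g i = x ^ₚ toℕ i *ₚ c (toℕ i)

    power-product : ∀ {k} → (Fin k → Poly n) → Monomial k → Poly n
    power-product {k} x m = productₚ (List.map (λ j → x j ^ₚ toℕ (Vec.lookup m j)) (List.allFin k))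

    -- Splitting off the first exponent gives the powers of `x zero` with sums over the later
    -- variables as coefficients. The family `x` has its own length `k`, so that the induction drops
    -- variables while the ring stays the same.
    sum-monomials≈lin : ∀ {k} (x : Fin k → Poly n) a →
      sumₚ (List.map (λ m → con (a (exponents m)) *ₚ power-product x m) (monomials k)) ≈ₚ
      lin q (λ _ _ → F.0#) x a
    sum-monomials≈lin {zero}  x a = transₚ (+-identityʳ _) (*-identityʳ _)
    sum-monomials≈lin {suc k} x a = begin
      sumₚ (List.map term (monomials (suc k)))
        ≈⟨ sum-product _∷_ term (List.allFin q) (monomials k) ⟩
      sumₚ (List.map (λ i → sumₚ (List.map (λ m → term (i ∷ m)) (monomials k))) (List.allFin q))
        ≈⟨ sum-cong (λ i → transₚ
             (transₚ (sum-cong (term-∷ i) (monomials k)) (sum-scale (x zero ^ₚ toℕ i) _ (monomials k)))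
             (*-congˡ (sum-monomials≈lin (x ∘ suc) (a ∘ (toℕ i ∷_))))) (List.allFin q) ⟩
      sumₚ (List.map (λ i → x zero ^ₚ toℕ i *ₚ lin q _ (x ∘ suc) (a ∘ (toℕ i ∷_))) (List.allFin q))
        ≈⟨ horner-0 q (λ i → lin q _ (x ∘ suc) (a ∘ (i ∷_))) (x zero) ⟩
      lin q (λ _ _ → F.0#) x a ∎
      where
      term : Monomial (suc k) → Poly n
      term m = con (a (exponents m)) *ₚ power-product x m
      term-∷ : ∀ i m → term (i ∷ m) ≈ₚ
        x zero ^ₚ toℕ i *ₚ (con (a (toℕ i ∷ exponents m)) *ₚ power-product (x ∘ suc) m)
      term-∷ i m = begin
        con (a (toℕ i ∷ exponents m)) *ₚ power-product x (i ∷ m)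
          ≡⟨ ≡.cong (λ z → con (a (toℕ i ∷ exponents m)) *ₚ productₚ z)
               (map-allFin-suc k (λ j → x j ^ₚ toℕ (Vec.lookup (i ∷ m) j))) ⟩
        con (a (toℕ i ∷ exponents m)) *ₚ (x zero ^ₚ toℕ i *ₚ power-product (x ∘ suc) m)
          ≈⟨ solve 3 (λ a y p → a :* (y :* p) := y :* (a :* p)) reflₚ _ _ _ ⟩
        x zero ^ₚ toℕ i *ₚ (con (a (toℕ i ∷ exponents m)) *ₚ power-product (x ∘ suc) m) ∎

  -- Degrees read off from Newton coefficients.

  ∈-monomials : ∀ {n} (m : Monomial n) → m ∈ monomials n
  ∈-monomials []      = here ≡.refl
  ∈-monomials (i ∷ m) = ∈-cartesianProductWith⁺ _∷_ (∈-allFin i) (∈-monomials m)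

  exponents-injective : ∀ {n} → Injective _≡_ _≡_ (exponents {n})
  exponents-injective {x = []}    {[]}    eq = ≡.refl
  exponents-injective {x = _ ∷ _} {_ ∷ _} eq = ≡.cong₂ _∷_
    (Fin.toℕ-injective (Vec.∷-injectiveˡ eq)) (exponents-injective (Vec.∷-injectiveʳ eq))

  fromExponents : ∀ {n} {m : Vec ℕ n} → All (_< q) m → Monomial n
  fromExponents []          = []
  fromExponents (i<q ∷ m<q) = Fin.fromℕ< i<q ∷ fromExponents m<q

  exponents-fromExponents : ∀ {n} {m : Vec ℕ n} (m<q : All (_< q) m) →
                            exponents (fromExponents m<q) ≡ m
  exponents-fromExponents []          = ≡.refl
  exponents-fromExponents (i<q ∷ m<q) =
    ≡.cong₂ _∷_ (Fin.toℕ-fromℕ< i<q) (exponents-fromExponents m<q)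

  exponents<q : ∀ {n} (m : Monomial n) → All (_< q) (exponents m)
  exponents<q []      = []
  exponents<q (i ∷ m) = Fin.toℕ<n i ∷ exponents<q m

  truncate : ∀ {n} → (Vec ℕ n → F.Carrier) → Vec ℕ n → F.Carrier
  truncate a m with All.all? (ℕ._<? q) m
  ... | yes _ = a m
  ... | no  _ = F.0#

  truncate≈ : ∀ {n} (a : Vec ℕ n → F.Carrier) {m} → All (_< q) m → truncate a m F.≈ a m
  truncate≈ a {m} m<q with All.all? (ℕ._<? q) m
  ... | yes _   = F.refl
  ... | no  m≮q = contradiction m<q m≮q

  -- `LinBelow` demands zeros also at vectors with an entry of `q` or more, which `lin` never reads;
  -- `truncate` puts them there.
  LinBelow-intro : ∀ {n k} {η : Fin k → ℕ → F.Carrier} {x : Fin k → Poly n} {d a} →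
                   (∀ {m} → All (_< q) m → d ≤ Vec.sum m → a m F.≈ F.0#) →
                   P.LinBelow q η x d (P.lin q η x a)
  LinBelow-intro {d = d} {a} a≈0 =
    truncate a , truncate≈0 , P.lin-cong q _ _ (F.sym ∘ truncate≈ a)
    where
    truncate≈0 : ∀ m → d ≤ Vec.sum m → truncate a m F.≈ F.0#
    truncate≈0 m d≤ with All.all? (ℕ._<? q) m
    ... | yes m<q = a≈0 m<q d≤
    ... | no  _   = F.refl

  LinBelow-resp : ∀ {n k} {η : Fin k → ℕ → F.Carrier} {x : Fin k → Poly n} {d y z} →
                  y ≈ₚ z → P.LinBelow q η x d y → P.LinBelow q η x d z
  LinBelow-resp y≈z (a , a≈0 , y≈) = a , a≈0 , transₚ (symₚ y≈z) y≈

  -- Equal elements of the quotient have equal values everywhere, and by `lin-injective` the values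
  -- determine the coefficients.
  lin-unique : ∀ {n} {η : Fin n → ℕ → F.Carrier} → (∀ j → DistinctBelow q (η j)) →
               ∀ {a a′} → P.lin q η X a ≈ₚ P.lin q η X a′ → ∀ {m} → All (_< q) m → a m F.≈ a′ m
  lin-unique distinct {a} {a′} eq = lin-injective q distinct λ ρ →
    F.trans (F.sym (eval-lin ρ _ X a)) (F.trans (eval-cong ρ eq) (eval-lin ρ _ X a′))

  ⊔₋-< : ∀ {i δ k} → i < k → δ <₋ [ k ] → ([ i ] ⊔₋ δ) <₋ [ k ]
  ⊔₋-< {δ = ⊥₋}    i<k δ<k          = Strict.[ i<k ]
  ⊔₋-< {δ = [ _ ]} i<k Strict.[ j<k ] = Strict.[ ℕ.⊔-lub i<k j<k ]

  ⊔₋-<⁻ : ∀ {i} δ {k} → ([ i ] ⊔₋ δ) <₋ [ k ] → i < k × δ <₋ [ k ]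
  ⊔₋-<⁻ ⊥₋    Strict.[ i<k ] = i<k , Strict.⊥₋<[ _ ]
  ⊔₋-<⁻ [ j ] Strict.[ i⊔j<k ] =
    ℕ.m⊔n<o⇒m<o _ j i⊔j<k , Strict.[ ℕ.m⊔n<o⇒n<o _ j i⊔j<k ]

  module _ {a p} {A : Set a} {P : A → Set p} (P? : ∀ m → Dec (P m)) (d : A → ℕ) {k : ℕ} where
    private
      maximum : List A → ℕ ₋
      maximum = foldr (λ m δ → if does (P? m) then δ else ([ d m ] ⊔₋ δ)) ⊥₋

    maximum<⁺ : (∀ m → ¬ P m → d m < k) → ∀ ms → maximum ms <₋ [ k ]
    maximum<⁺ small []       = Strict.⊥₋<[ k ]
    maximum<⁺ small (m ∷ ms) with P? m
    ... | yes _  = maximum<⁺ small ms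
    ... | no  ¬p = ⊔₋-< (small m ¬p) (maximum<⁺ small ms)

    maximum<⁻ : ∀ ms → maximum ms <₋ [ k ] → ∀ {m} → m ∈ ms → ¬ P m → d m < k
    maximum<⁻ (m ∷ ms) δ<k m∈ ¬p with P? m | m∈
    ... | yes p | here ≡.refl = contradiction p ¬p
    ... | yes _ | there m∈ms  = maximum<⁻ ms δ<k m∈ms ¬p
    ... | no _  | here ≡.refl = proj₁ (⊔₋-<⁻ (maximum ms) δ<k)
    ... | no _  | there m∈ms  = maximum<⁻ ms (proj₂ (⊔₋-<⁻ (maximum ms) δ<k)) m∈ms ¬p

  module _ {n} (r : Reduced n) {k : ℕ} where
    private
      zero? : ∀ m → Dec (r m F.≈ F.0#)
      zero? m = r m ≟ F.0#

    deg<⁺ : (∀ m → k ≤ degᵐ m → r m F.≈ F.0#) → deg r <₋ [ k ]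
    deg<⁺ r≈0 = maximum<⁺ zero? degᵐ (λ m r≉0 → ℕ.≰⇒> (r≉0 ∘ r≈0 m)) (monomials n)

    deg<⁻ : deg r <₋ [ k ] → ∀ m → k ≤ degᵐ m → r m F.≈ F.0#
    deg<⁻ δ<k m k≤ = decidable-stable (r m ≟ F.0#) λ r≉0 →
      ℕ.<⇒≱ (maximum<⁻ zero? degᵐ (monomials n) δ<k (∈-monomials m) r≉0) k≤

  extend : ∀ {n} → Reduced n → Vec ℕ n → F.Carrier
  extend r m with All.all? (ℕ._<? q) m
  ... | yes m<q = r (fromExponents m<q)
  ... | no  _   = F.0#

  extend-exponents : ∀ {n} (r : Reduced n) m → extend r (exponents m) ≡ r m
  extend-exponents r m with All.all? (ℕ._<? q) (exponents m)
  ... | yes m<q = ≡.cong r (exponents-injective (exponents-fromExponents m<q))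
  ... | no  m≮q = contradiction (exponents<q m) m≮q

  ⟦⟧≈lin : ∀ {n} (r : Reduced n) a → (∀ m → a (exponents m) F.≈ r m) →
           ⟦ r ⟧ ≈ₚ P.lin q (λ _ _ → F.0#) X a
  ⟦⟧≈lin {n} r a a≈r = transₚ
    (sum-cong (λ m → *-cong (con-cong (F.sym (a≈r m))) reflₚ) (monomials n))
    (sum-monomials≈lin X a)

  -- A reduced representative is an expansion whose points are all zero, so only a change of points
  -- remains.
  Degree<⇒LinBelow : ∀ {n d} η {x : Poly n} → Degree< d x → P.LinBelow q η X d x
  Degree<⇒LinBelow {d = d} η (δ , (r , ⟦r⟧≈x , ≡.refl) , δ<d) = P.LinBelow-change q η
    (LinBelow-resp (transₚ (symₚ (⟦⟧≈lin r (extend r) (F.reflexive ∘ extend-exponents r))) ⟦r⟧≈x)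
      (LinBelow-intro λ {m} m<q d≤ → F.trans
        (F.reflexive (≡.trans
          (≡.cong (extend r) (≡.sym (exponents-fromExponents m<q))) (extend-exponents r _)))
        (deg<⁻ r δ<d (fromExponents m<q)
          (ℕ.≤-trans d≤ (ℕ.≤-reflexive (≡.cong Vec.sum (≡.sym (exponents-fromExponents m<q))))))))

  LinBelow⇒Degree< : ∀ {n d η} {x : Poly n} → P.LinBelow q η X d x → Degree< d x
  LinBelow⇒Degree< x∈ with P.LinBelow-change q (λ _ _ → F.0#) x∈
  ... | a , a≈0 , x≈ =
    _ , (a ∘ exponents , transₚ (⟦⟧≈lin _ a (λ _ → F.refl)) (symₚ x≈) , ≡.refl) ,
    deg<⁺ (a ∘ exponents) (a≈0 ∘ exponents)

  Degree≤⇒Degree< : ∀ {n e} {x : Poly n} → Degree≤ e x → Degree< (suc e) x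
  Degree≤⇒Degree< (δ , δ≡ , NonStrict.⊥₋≤ _)  = δ , δ≡ , Strict.⊥₋<[ _ ]
  Degree≤⇒Degree< (δ , δ≡ , NonStrict.[ i≤e ]) = δ , δ≡ , Strict.[ s≤s i≤e ]

  Degree<⇒Degree≤ : ∀ {n e} {x : Poly n} → Degree< (suc e) x → Degree≤ e x
  Degree<⇒Degree≤ (δ , δ≡ , Strict.⊥₋<[ _ ]) = δ , δ≡ , NonStrict.⊥₋≤ _
  Degree<⇒Degree≤ (δ , δ≡ , Strict.[ i<1+e ]) = δ , δ≡ , NonStrict.[ ℕ.s≤s⁻¹ i<1+e ]

-- Finite functions, filtered lists and translation of vectors.

open import Data.Nat.Base using (_+_; _*_; _^_)

funToFin-cong : ∀ {m n} {f g : Fin m → Fin n} → (∀ i → f i ≡ g i) → funToFin f ≡ funToFin g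
funToFin-cong {zero}  f≡g = ≡.refl
funToFin-cong {suc m} f≡g = ≡.cong₂ Fin.combine (f≡g zero) (funToFin-cong (f≡g ∘ suc))

finToFun-injective : ∀ m n {x y : Fin (m ^ n)} →
                     (∀ i → finToFun {m} {n} x i ≡ finToFun {m} {n} y i) → x ≡ y
finToFun-injective m n {x} {y} x≡y = ≡.trans (≡.sym (Fin.funToFin-finToFin {n} {m} x))
  (≡.trans (funToFin-cong x≡y) (Fin.funToFin-finToFin {n} {m} y))

index-∈-lookup : ∀ {a} {A : Set a} (xs : List A) i → Any.index (∈-lookup {xs = xs} i) ≡ i
index-∈-lookup (x ∷ xs) zero    = ≡.refl
index-∈-lookup (x ∷ xs) (suc i) = ≡.cong suc (index-∈-lookup xs i)

module _ {a p r} {A : Set a} {P : A → Set p} {R : A → Set r}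
         (P? : Decidable P) (R? : Decidable R) where

  length-filter-split : ∀ xs → List.length (List.filter P? xs) ≡
    List.length (List.filter (λ x → P? x ×-dec ¬? (R? x)) xs) +
    List.length (List.filter (λ x → P? x ×-dec R? x) xs)
  length-filter-split []       = ≡.refl
  length-filter-split (x ∷ xs) with does (P? x) | does (R? x)
  ... | true  | true  = ≡.trans (≡.cong suc (length-filter-split xs)) (≡.sym (ℕ.+-suc _ _))
  ... | true  | false = ≡.cong suc (length-filter-split xs)
  ... | false | _     = length-filter-split xs

sum-+ᵛ : ∀ {n} (k m : Vec ℕ n) → Vec.sum (k +ᵛ m) ≡ Vec.sum k + Vec.sum m
sum-+ᵛ []      []      = ≡.refl
sum-+ᵛ (k ∷ k⃗) (i ∷ m) = begin
  k + i + Vec.sum (k⃗ +ᵛ m)          ≡⟨ ≡.cong (_+_ (k + i)) (sum-+ᵛ k⃗ m) ⟩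
  k + i + (Vec.sum k⃗ + Vec.sum m)   ≡⟨ interchange k i _ _ ⟩
  k + Vec.sum k⃗ + (i + Vec.sum m)   ∎
  where open ≡.≡-Reasoning

+ᵛ-cancelˡ : ∀ {n} (k : Vec ℕ n) {m m′} → k +ᵛ m ≡ k +ᵛ m′ → m ≡ m′
+ᵛ-cancelˡ []      {[]}    {[]}      eq = ≡.refl
+ᵛ-cancelˡ (k ∷ k⃗) {i ∷ m} {i′ ∷ m′} eq = ≡.cong₂ _∷_
  (ℕ.+-cancelˡ-≡ k i i′ (Vec.∷-injectiveˡ eq)) (+ᵛ-cancelˡ k⃗ (Vec.∷-injectiveʳ eq))

k≤k+ᵛm : ∀ {n} (k m : Vec ℕ n) → Pointwise _≤_ k (k +ᵛ m)
k≤k+ᵛm []      []      = []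
k≤k+ᵛm (k ∷ k⃗) (i ∷ m) = ℕ.m≤m+n k i ∷ k≤k+ᵛm k⃗ m

≤⇒∃+ᵛ : ∀ {n} {k w : Vec ℕ n} → Pointwise _≤_ k w → ∃[ m ] w ≡ k +ᵛ m
≤⇒∃+ᵛ []          = [] , ≡.refl
≤⇒∃+ᵛ (k≤i ∷ k≤w) with ≤⇒∃+ᵛ k≤w
... | m , ≡.refl = (_ ∷ m) , ≡.cong (_∷ _) (≡.sym (ℕ.m+[n∸m]≡n k≤i))

All<-+ᵛ⁻ : ∀ {n q} (k m : Vec ℕ n) → All (_< q) (k +ᵛ m) → All (_< q) m
All<-+ᵛ⁻ []      []      []          = []
All<-+ᵛ⁻ (k ∷ k⃗) (i ∷ m) (i<q ∷ m<q) = ℕ.≤-<-trans (ℕ.m≤n+m i k) i<q ∷ All<-+ᵛ⁻ k⃗ m m<q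

o≡m*n⇒m/o≡1/n : ∀ m n {o} .{{_ : NonZero m}} .{{_ : NonZero n}} .{{_ : NonZero o}} →
                o ≡ m * n → (+ m) / o ≡ (+ 1) / n
o≡m*n⇒m/o≡1/n (suc m) (suc n) ≡.refl = ℚ.fromℚᵘ-cong {mkℚᵘ (+ suc m) _} {mkℚᵘ (+ 1) n}
  (*≡* (≡.trans (≡.sym (ℤ.pos-* (suc m) (suc n))) (≡.sym (ℤ.*-identityˡ _))))

-- Counting polynomials by the support of their coefficients.

module Counting {c ℓ} (F : Field c ℓ) (q : ℕ) (ξ : Ordering q (Field.setoid F)) where
  private module F = Field F
  open ReducedPolynomials F q ξ
  open FieldProperties F using (DistinctBelow)
  open QuotientRing F q ξ
  open Degrees F q ξ
  private module I = Inverse index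

  Supported : ∀ {a d} {A : Set a} → (A → Set d) → (A → F.Carrier) → Set _
  Supported D a = ∀ m → ¬ D m → a m F.≈ F.0#

  -- A function into the field that vanishes off `D` amounts to a number below `q ^ |D|`: its digits
  -- in base `q` are the indices of the values along `ms`.
  module Codes {a d} {A : Set a} {D : A → Set d} (D? : Decidable D) (ms : List A)
               (ms-unique : Unique ms) (∈ms : ∀ {m} → D m → m ∈ ms)
               (ms∈ : ∀ {m} → m ∈ ms → D m) where

    decode : Fin (q ^ List.length ms) → A → F.Carrier
    decode x m with D? m
    ... | yes p = I.from (finToFun x (Any.index (∈ms p)))
    ... | no  _ = F.0#

    decode-supported : ∀ x → Supported D (decode x)
    decode-supported x m ¬p with D? m
    ... | yes p = contradiction p ¬p
    ... | no  _ = F.refl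

    -- Since `ms` has no repetitions, membership proofs are unique and the position found through
    -- `∈ms` is `i` itself.
    decode-lookup : ∀ x i → decode x (List.lookup ms i) ≡ I.from (finToFun x i)
    decode-lookup x i with D? (List.lookup ms i)
    ... | yes p = ≡.cong (I.from ∘ finToFun x) (≡.trans
      (≡.cong Any.index (unique⇒irrelevant ms-unique (∈ms p) (∈-lookup i))) (index-∈-lookup ms i))
    ... | no ¬p = contradiction (ms∈ (∈-lookup i)) ¬p

    decode-injective : ∀ {x y} → (∀ {m} → D m → decode x m F.≈ decode y m) → x ≡ y
    decode-injective {x} {y} x≈y = finToFun-injective q (List.length ms) λ i →
      Bijection.injective ξ (F.trans
        (F.reflexive (≡.sym (decode-lookup x i)))
        (F.trans (x≈y (ms∈ (∈-lookup i))) (F.reflexive (decode-lookup y i))))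

    encode : (A → F.Carrier) → Fin (q ^ List.length ms)
    encode a = funToFin (λ i → I.to (a (List.lookup ms i)))

    decode-encode : ∀ {a} → Supported D a → ∀ m → decode (encode a) m F.≈ a m
    decode-encode {a} a≈0 m with D? m
    ... | no ¬p = F.sym (a≈0 m ¬p)
    ... | yes p = F.trans
      (F.reflexive (≡.cong I.from (Fin.finToFun-funToFin (I.to ∘ a ∘ List.lookup ms) (Any.index (∈ms p)))))
      (F.trans (I.strictlyInverseʳ _)
        (F.reflexive (≡.cong a (≡.sym (Any.lookup-index (∈ms p))))))

  boxes : ∀ n → List (Vec ℕ n)
  boxes n = List.map exponents (monomials n)

  monomials-unique : ∀ n → Unique (monomials n)
  monomials-unique zero    = ListAll.[] AllPairs.∷ AllPairs.[]
  monomials-unique (suc n) = Unique.cartesianProductWith⁺ _∷_ Vec.∷-injective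
    (Unique.allFin⁺ q) (monomials-unique n)

  boxes-unique : ∀ n → Unique (boxes n)
  boxes-unique n = Unique.map⁺ exponents-injective (monomials-unique n)

  ∈-boxes : ∀ {n} {m : Vec ℕ n} → All (_< q) m → m ∈ boxes n
  ∈-boxes m<q = ≡.subst (_∈ boxes _) (exponents-fromExponents m<q)
    (∈-map⁺ exponents (∈-monomials (fromExponents m<q)))

  module _ {n d b} {D : Vec ℕ n → Set d} (D? : Decidable D) (D⇒<q : ∀ {m} → D m → All (_< q) m)
           {η : Fin n → ℕ → F.Carrier} (distinct : ∀ j → DistinctBelow q (η j))
           {B : Set b} (g : B → Poly n) where

    open Codes D? (List.filter D? (boxes n)) (Unique.filter⁺ D? (boxes-unique n))
      (λ p → ∈-filter⁺ D? (∈-boxes (D⇒<q p)) p) (proj₂ ∘ ∈-filter⁻ D? {xs = boxes n})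

    -- The map `g` forgets the side conditions that an element carries, so one count serves both all
    -- outcomes and the favourable ones. Injectivity is `lin-unique`.
    lin-ordering : (∀ a → Supported D a → ∃[ y ] g y ≈ₚ P.lin q η X a) →
                   (∀ y → ∃[ a ] (Supported D a × g y ≈ₚ P.lin q η X a)) →
                   Ordering (q ^ List.length (List.filter D? (boxes n))) (On.setoid (𝒫 n) g)
    lin-ordering element coefficients = record
      { to        = to
      ; cong      = λ { ≡.refl → reflₚ }
      ; bijective =
          (λ {x} {y} x≈y → decode-injective λ p → lin-unique distinct
            (transₚ (symₚ (to≈ x)) (transₚ x≈y (to≈ y))) (D⇒<q p))
        , λ y → let a , a≈0 , y≈ = coefficients y in
            encode a , λ { ≡.refl → transₚ (to≈ (encode a))
              (transₚ (P.lin-cong q η X λ {m} _ → decode-encode a≈0 m) (symₚ y≈)) }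
      }
      where
      to : Fin _ → B
      to x = proj₁ (element (decode x) (decode-supported x))
      to≈ : ∀ x → g (to x) ≈ₚ P.lin q η X (decode x)
      to≈ x = proj₂ (element (decode x) (decode-supported x))

  restrict : ∀ {n d} {D : Vec ℕ n → Set d} → Decidable D → (Vec ℕ n → F.Carrier) → Vec ℕ n → F.Carrier
  restrict D? a m with D? m
  ... | yes _ = a m
  ... | no  _ = F.0#

  restrict-supported : ∀ {n d} {D : Vec ℕ n → Set d} (D? : Decidable D) a → Supported D (restrict D? a)
  restrict-supported D? a m ¬p with D? m
  ... | yes p = contradiction p ¬p
  ... | no  _ = F.refl

  restrict≈ : ∀ {n d} {D : Vec ℕ n → Set d} (D? : Decidable D) a {m} → (¬ D m → a m F.≈ F.0#) →
              restrict D? a m F.≈ a m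
  restrict≈ D? a {m} a≈0 with D? m
  ... | yes _ = F.refl
  ... | no ¬p = F.sym (a≈0 ¬p)

  lookup-m₀≤q : ∀ n u {v} → v ≤ q → ∀ j → Vec.lookup (m₀ n u v) j ≤ q
  lookup-m₀≤q (suc n) zero    v≤q zero    = v≤q
  lookup-m₀≤q (suc n) zero    v≤q (suc j) =
    ≡.subst (_≤ q) (≡.sym (Vec.lookup∘tabulate (const 0) j)) z≤n
  lookup-m₀≤q (suc n) (suc u) v≤q zero    = ℕ.m∸n≤m q 1
  lookup-m₀≤q (suc n) (suc u) v≤q (suc j) = lookup-m₀≤q n u v≤q j

  -- Each variable takes off `q ∸ 1` until `u` is used up. If the variables run out first, the bound
  -- by `n * (q ∸ 1)` forces the remainder to be zero.
  sum-m₀ : ∀ n u v → u * (q ∸ 1) + v ≤ n * (q ∸ 1) → v < q ∸ 1 → Vec.sum (m₀ n u v) ≡ u * (q ∸ 1) + v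
  sum-m₀ zero    u       v d≤ v< = ≡.sym (ℕ.n≤0⇒n≡0 d≤)
  sum-m₀ (suc n) zero    v d≤ v< = ≡.trans (≡.cong (_+_ v) (sum-zeros n)) (ℕ.+-identityʳ v)
    where
    sum-zeros : ∀ n → Vec.sum (Vec.tabulate {n = n} (const 0)) ≡ 0
    sum-zeros zero    = ≡.refl
    sum-zeros (suc n) = sum-zeros n
  sum-m₀ (suc n) (suc u) v d≤ v< = ≡.trans
    (≡.cong (_+_ (q ∸ 1)) (sum-m₀ n u v
      (ℕ.+-cancelˡ-≤ (q ∸ 1) _ _ (ℕ.≤-trans (ℕ.≤-reflexive (≡.sym (ℕ.+-assoc (q ∸ 1) _ v))) d≤)) v<))
    (≡.sym (ℕ.+-assoc (q ∸ 1) (u * (q ∸ 1)) v))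

  -- Free and forced coefficients of P.

  module _ {n} (k : Vec ℕ n) (s e : ℕ) where

    -- Killed m says that the coefficient of P at m contributes to fP in degree ≥ |k| + s.
    Reached Killed Survivor : Vec ℕ n → Set
    Reached m  = All (_< q) m × Vec.sum m ≤ e
    Killed m   = All (_< q) (k +ᵛ m) × s ≤ Vec.sum m
    Survivor m = Reached m × ¬ Killed m

    Reached? : Decidable Reached
    Reached? m = All.all? (ℕ._<? q) m ×-dec (Vec.sum m ℕ.≤? e)

    Killed? : Decidable Killed
    Killed? m = All.all? (ℕ._<? q) (k +ᵛ m) ×-dec (s ℕ.≤? Vec.sum m)

    Survivor? : Decidable Survivor
    Survivor? m = Reached? m ×-dec ¬? (Killed? m)

    -- Translation by `k` and `exponents` are injective and the lists have no repetitions, so it is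
    -- enough that the two images have the same members.
    killed-count : List.length (List.filter (λ m → Reached? m ×-dec Killed? m) (boxes n)) ≡
                   ∣U[ s , e ]∣ k
    killed-count = begin
      List.length killed                                ≡⟨ List.length-map (k +ᵛ_) killed ⟨
      List.length (List.map (k +ᵛ_) killed)             ≡⟨ ↭-length (∼bag⇒↭ (unique∧set⇒bag
          (Unique.map⁺ (+ᵛ-cancelˡ k) (Unique.filter⁺ _ (boxes-unique n)))
          (Unique.map⁺ exponents-injective (Unique.filter⁺ _ (monomials-unique n)))
          (mk⇔ forth back))) ⟩
      List.length (List.map exponents lifted)           ≡⟨ List.length-map exponents lifted ⟩
      List.length lifted                                ∎
      where
      open ≡.≡-Reasoning
      RK? = λ m → Reached? m ×-dec Killed? m
      killed = List.filter RK? (boxes n)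
      lifted = List.filter (U[ s , e ]? k) (monomials n)

      forth : ∀ {w} → w ∈ List.map (k +ᵛ_) killed → w ∈ List.map exponents lifted
      forth w∈ with ∈-map⁻ (k +ᵛ_) w∈
      ... | m , m∈ , ≡.refl with ∈-filter⁻ RK? {xs = boxes n} m∈
      ... | _ , (_ , m≤e) , k+m<q , s≤m = ≡.subst (_∈ List.map exponents lifted) w≡
        (∈-map⁺ exponents (∈-filter⁺ (U[ s , e ]? k) (∈-monomials _)
          -- The excess `t` over the degree of `k` is the degree of `m`; the bound reads
          -- `t < suc e`, hence the `s≤s`.
          ( Vec.sum m , s≤s m≤e , s≤m
          , ≡.trans (≡.cong Vec.sum w≡) (sum-+ᵛ k m)
          , ≡.subst (Pointwise _≤_ k) (≡.sym w≡) (k≤k+ᵛm k m))))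
        where w≡ = exponents-fromExponents k+m<q

      back : ∀ {w} → w ∈ List.map exponents lifted → w ∈ List.map (k +ᵛ_) killed
      back w∈ with ∈-map⁻ exponents w∈
      ... | m′ , m′∈ , ≡.refl with ∈-filter⁻ (U[ s , e ]? k) {xs = monomials n} m′∈
      ... | _ , t , s≤s t≤e , s≤t , deg≡ , k≤m′ with ≤⇒∃+ᵛ k≤m′
      ... | m , m′≡ = ≡.subst (_∈ List.map (k +ᵛ_) killed) (≡.sym m′≡)
        (∈-map⁺ (k +ᵛ_) (∈-filter⁺ RK? (∈-boxes m<q)
          ( (m<q , ≡.subst (_≤ e) (≡.sym sum≡t) t≤e)
          , (k+m<q , ≡.subst (s ≤_) (≡.sym sum≡t) s≤t))))
        where
        k+m<q = ≡.subst (All (_< q)) m′≡ (exponents<q m′)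
        m<q = All<-+ᵛ⁻ k m k+m<q
        sum≡t = ℕ.+-cancelˡ-≡ (Vec.sum k) _ t
          (≡.trans (≡.sym (sum-+ᵛ k m)) (≡.trans (≡.cong Vec.sum (≡.sym m′≡)) deg≡))

  -- The degree of the product and the resulting probability.

  module _ {n} {k : Vec ℕ n} (k≤q : ∀ j → Vec.lookup k j ≤ q) (1<q : 1 < q) (s e : ℕ) where
    η : Fin n → ℕ → F.Carrier
    η = P.shift {n} q k (const ξ̃)

    η-distinct : ∀ j → DistinctBelow q (η j)
    η-distinct j = shifted-distinct (k≤q j)

    fₖ : Poly n
    fₖ = productₚ (List.map (λ j → b (Vec.lookup k j) (X j)) (List.allFin n))

    f*lin : ∀ {y a} → y ≈ₚ P.lin q η X a → fₖ *ₚ y ≈ₚ P.lin q (const ξ̃) X (P.delayᵛ {n} q k a)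
    f*lin {y} {a} y≈ = transₚ (*-cong (≡ₚ (product-b≡newtonᵛ k k≤q X)) y≈)
      (P.lin-delay q k (const ξ̃) X a (newton-q≈0 1<q))
      where
      ≡ₚ : ∀ {y z : Poly n} → y ≡ z → y ≈ₚ z
      ≡ₚ ≡.refl = reflₚ

    Degree≤⇒lin : ∀ {y} → Degree≤ e y → ∃[ a ] (Supported (Reached k s e) a × y ≈ₚ P.lin q η X a)
    Degree≤⇒lin y≤ with Degree<⇒LinBelow η (Degree≤⇒Degree< y≤)
    ... | a , a≈0 , y≈ = restrict D? a , restrict-supported D? a ,
      -- A coefficient removed by `restrict` lies at a vector that `lin` does not read or at one of
      -- degree above `e`, where it is zero already.
      transₚ y≈ (symₚ (P.lin-cong q η X λ {m} m<q → restrict≈ D? a λ ¬p →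
        a≈0 m (ℕ.≰⇒> (λ m≤e → ¬p (m<q , m≤e)))))
      where D? = Reached? k s e

    lin-Degree≤ : ∀ {a} → Supported (Reached k s e) a → Degree≤ e (P.lin q η X a)
    lin-Degree≤ {a} a≈0 = Degree<⇒Degree≤ (LinBelow⇒Degree<
      (a , (λ m e<m → a≈0 m λ (_ , m≤e) → ℕ.<⇒≱ e<m m≤e) , reflₚ))

    -- At a killed `m`, the coefficient of `y` is that of the product at `k +ᵛ m`, where the degree
    -- bound and uniqueness of coefficients make it zero.
    Degree<⇒Survivor : ∀ {y a} → Supported (Reached k s e) a → y ≈ₚ P.lin q η X a →
                       Degree< (Vec.sum k + s) (fₖ *ₚ y) → Supported (Survivor k s e) a
    Degree<⇒Survivor {y} {a} a≈0 y≈ fy< m ¬p with Reached? k s e m | Killed? k s e m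
    ... | no ¬r | _     = a≈0 m ¬r
    ... | yes r | no ¬z = contradiction (r , ¬z) ¬p
    ... | yes r | yes (k+m<q , s≤m) with Degree<⇒LinBelow (const ξ̃) fy<
    ... | a′ , a′≈0 , fy≈ = F.trans (F.reflexive (≡.sym (P.delayᵛ-+ {n} q k a m)))
      (F.trans (lin-unique (λ _ → shifted-distinct z≤n) (transₚ (symₚ (f*lin y≈)) fy≈) k+m<q)
        (a′≈0 (k +ᵛ m) (≡.subst (Vec.sum k + s ≤_) (≡.sym (sum-+ᵛ k m)) (ℕ.+-monoʳ-≤ (Vec.sum k) s≤m))))

    -- In degree at least `Vec.sum k + s`, a coefficient of the product is either a zero inserted by
    -- `delay` or a coefficient of `y` at a killed vector.
    Survivor⇒Degree< : ∀ {y a} → Supported (Survivor k s e) a → y ≈ₚ P.lin q η X a →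
                       Degree< (Vec.sum k + s) (fₖ *ₚ y)
    Survivor⇒Degree< {y} {a} a≈0 y≈ = LinBelow⇒Degree< (LinBelow-resp (symₚ (f*lin y≈))
      (LinBelow-intro λ {m} m<q d+s≤ → P.delayᵛ-zero {n} q k a m λ { m′ ≡.refl →
        a≈0 m′ λ (_ , ¬killed) → ¬killed (m<q ,
          ℕ.+-cancelˡ-≤ (Vec.sum k) _ _ (≡.subst (Vec.sum k + s ≤_) (sum-+ᵛ k m′) d+s≤)) }))

    -- The event forces the killed coefficients to vanish and leaves the survivors free. The reached
    -- vectors are the survivors together with as many killed ones as `U[ s , e ] k` has members, so
    -- the powers of `q` cancel to the stated ratio.
    probability : Probability (𝒫≤ n e) (λ (y , _) → Degree< (Vec.sum k + s) (fₖ *ₚ y))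
      (_/_ (+ 1) (q ^ ∣U[ s , e ]∣ k) {{m^n≢0 q (∣U[ s , e ]∣ k)}})
    probability = record
      { outcomes      = q ^ reached
      ; favourable    = q ^ survivors
      ; outcomes≢0    = m^n≢0 q reached
      ; allOutcomes   = lin-ordering (Reached? k s e) proj₁ η-distinct proj₁
          (λ a a≈0 → (P.lin q η X a , lin-Degree≤ a≈0) , reflₚ)
          (λ (y , y≤) → Degree≤⇒lin y≤)
      ; allFavourable = lin-ordering (Survivor? k s e) (proj₁ ∘ proj₁) η-distinct (proj₁ ∘ proj₁)
          (λ a a≈0 → ((P.lin q η X a , lin-Degree≤ (λ m ¬r → a≈0 m (¬r ∘ proj₁)))
                     , Survivor⇒Degree< a≈0 reflₚ) , reflₚ)
          (λ ((y , y≤) , fy<) → let a , a≈0 , y≈ = Degree≤⇒lin y≤ in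
             a , Degree<⇒Survivor a≈0 y≈ fy< , y≈)
      ; ratio         = o≡m*n⇒m/o≡1/n (q ^ survivors) (q ^ U)
          {{m^n≢0 q survivors}} {{m^n≢0 q U}} {{m^n≢0 q reached}} outcomes≡
      }
      where
      reached survivors : ℕ
      reached   = List.length (List.filter (Reached? k s e) (boxes n))
      survivors = List.length (List.filter (Survivor? k s e) (boxes n))
      U = ∣U[ s , e ]∣ k
      outcomes≡ : q ^ reached ≡ q ^ survivors * q ^ U
      outcomes≡ = ≡.trans (≡.cong (q ^_) (≡.trans
        (length-filter-split (Reached? k s e) (Killed? k s e) (boxes n))
        (≡.cong (_+_ survivors) (killed-count k s e)))) (ℕ.^-distribˡ-+-* q survivors U)

claim3p6 : ∀ {c ℓ} (F : Field c ℓ) (q : ℕ) → IsPrimePower q →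
    (ξ : Ordering q (Field.setoid F)) →
    let open ReducedPolynomials F q ξ in
    (n : ℕ) → 1 ≤ n →
    (d u v : ℕ) → d ≤ n * (q ∸ 1) → d ≡ u * (q ∸ 1) + v → v < q ∸ 1 →
    (e s : ℕ) →
    Probability (𝒫≤ n e)
    (λ (P , _) → Degree< (d + s) (f n u v *ₚ P))
    (_/_ (+ 1) (q ^ ∣U[ s , e ]∣ (m₀ n u v)) {{m^n≢0 q (∣U[ s , e ]∣ (m₀ n u v))}})
claim3p6 F q _ ξ n _ _ u v d≤ ≡.refl v<q-1 e s =
  -- The general statement measures from the degree of `m₀`, which is `d` by `sum-m₀`.
  ≡.subst (λ d → Probability (𝒫≤ n e) (λ (P , _) → Degree< (d + s) (f n u v *ₚ P))
                   (_/_ (+ 1) (q ^ ∣U[ s , e ]∣ (m₀ n u v)) {{m^n≢0 q (∣U[ s , e ]∣ (m₀ n u v))}}))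
    (sum-m₀ n u v d≤ v<q-1)
    (probability (lookup-m₀≤q n u (ℕ.≤-trans (ℕ.<⇒≤ v<q-1) (ℕ.m∸n≤m q 1)))
      -- `1 < q` because `v < q ∸ 1` rules out `q ∸ 1 ≡ 0`.
      (ℕ.m∸n≢0⇒n<m λ q-1≡0 → ℕ.n≮0 (≡.subst (v <_) q-1≡0 v<q-1)) s e)
  where
  open ReducedPolynomials F q ξ
  open Counting F q ξ
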